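{- There is an algorithm that, given an undirected graph $G$ on $n$ vertices and an integer $k$, decides in time $7^k\cdot n^{O(1)}$ whether there is a set $S\subseteq V(G)$ of size at most $k$ such that every connected component of $G-S$ is either a claw-free graph or a triangle-free graph.
   Context: All graphs are finite, simple and undirected. The claw is $K_{1,3}$, the triangle is $C_3$, and claw-free (resp. triangle-free) means containing no claw (resp. triangle) as an induced subgraph. Different components of $G-S$ may be of different types. -}

module Defs where

open import Data.Bool using (Bool; true; false; not)
open import Data.Fin using (Fin; zero; suc)
open import Data.Fin.Properties using (_≟_)
open import Data.Fin.Subset using (Subset; _∈_; ∁; ∣_∣)
open import Data.List using (List; []; _∷_; tabulate)
open import Data.Nat using (ℕ; zero; suc; _+_; _≤_)
open import Data.Nat.Binary using (ℕᵇ; zero; 2[1+_]; 1+[2_]; fromℕ)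
open import Data.Product using (_×_; ∃-syntax)
open import Data.Sum using (_⊎_)
open import Data.Vec using (Vec; []; _∷_; lookup)
open import Function using (_⇔_)
open import Function.Definitions using (Injective)
open import Relation.Binary.Construct.Closure.ReflexiveTransitive using (Star)
open import Relation.Binary.PropositionalEquality using (_≡_; refl; sym)
open import Relation.Nullary using (¬_; does; yes; no; contradiction)

------------------------------------------------------------------------
-- Graphs

record Graph (n : ℕ) : Set where
  field
    adj        : Fin n → Fin n → Bool
    adj-sym    : ∀ u v → adj u v ≡ adj v u
    adj-irrefl : ∀ v → adj v v ≡ false

open Graph public

-- K₁,₃ with centre zero
claw : Graph 4
claw = record { adj = a ; adj-sym = a-sym ; adj-irrefl = a-irrefl }
  where
  a : Fin 4 → Fin 4 → Bool
  a zero    zero    = false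
  a zero    (suc _) = true
  a (suc _) zero    = true
  a (suc _) (suc _) = false

  a-sym : ∀ u v → a u v ≡ a v u
  a-sym zero    zero    = refl
  a-sym zero    (suc _) = refl
  a-sym (suc _) zero    = refl
  a-sym (suc _) (suc _) = refl

  a-irrefl : ∀ v → a v v ≡ false
  a-irrefl zero    = refl
  a-irrefl (suc _) = refl

triangle : Graph 3
triangle = record { adj = a ; adj-sym = a-sym ; adj-irrefl = a-irrefl }
  where
  a : Fin 3 → Fin 3 → Bool
  a u v = not (does (u ≟ v))

  a-sym : ∀ u v → a u v ≡ a v u
  a-sym u v with u ≟ v | v ≟ u
  ... | yes _   | yes _   = refl
  ... | no  _   | no  _   = refl
  ... | yes u≡v | no  v≢u = contradiction (sym u≡v) v≢u
  ... | no  u≢v | yes v≡u = contradiction (sym v≡u) u≢v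

  a-irrefl : ∀ v → a v v ≡ false
  a-irrefl v with v ≟ v
  ... | yes _   = refl
  ... | no  v≢v = contradiction refl v≢v

-- Induced subgraphs of G are represented by their vertex sets.
module _ {n : ℕ} (G : Graph n) where

  -- G[U] has an induced subgraph isomorphic to H
  HasInduced : Subset n → ∀ {m} → Graph m → Set
  HasInduced U {m} H =
    ∃[ f ] Injective _≡_ _≡_ f
         × (∀ (i : Fin m) → f i ∈ U)
         × (∀ i j → adj G (f i) (f j) ≡ adj H i j)

  ClawFree : Subset n → Set
  ClawFree U = ¬ HasInduced U claw

  TriangleFree : Subset n → Set
  TriangleFree U = ¬ HasInduced U triangle

  AdjacentIn : Subset n → Fin n → Fin n → Set
  AdjacentIn U u v = u ∈ U × v ∈ U × adj G u v ≡ true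

  ConnectedIn : Subset n → Fin n → Fin n → Set
  ConnectedIn U = Star (AdjacentIn U)

  -- C is the vertex set of a connected component of G[U]
  IsComponent : Subset n → Subset n → Set
  IsComponent U C =
    ∃[ u ] u ∈ U × (∀ v → v ∈ C ⇔ (v ∈ U × ConnectedIn U u v))

  IsSolution : Subset n → Set
  IsSolution S = ∀ C → IsComponent (∁ S) C → ClawFree C ⊎ TriangleFree C

  HasSolutionOfSize≤ : ℕ → Set
  HasSolutionOfSize≤ k = ∃[ S ] ∣ S ∣ ≤ k × IsSolution S

------------------------------------------------------------------------
-- Model of computation
--
-- A first-order functional language with general recursion over binary
-- trees.  A program is a finite table of functions together with an
-- entry expression, so that every evaluation rule is, for a fixed
-- program, a bounded number of elementary pointer operations (trees are
-- built and passed by reference, and there is no equality test on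
-- trees).  The number of rules applied is therefore, up to a constant
-- factor depending only on the program, the unit-cost time on a RAM or
-- pointer machine.

data Tree : Set where
  leaf : Tree
  node : Tree → Tree → Tree

-- Expressions over functions of the given arities, with v variables in
-- scope (de Bruijn indices).  The second branch of caseₑ binds the left
-- subtree as index 0 and the right subtree as index 1.
data Expr {F : ℕ} (arity : Fin F → ℕ) (v : ℕ) : Set where
  varₑ  : Fin v → Expr arity v
  leafₑ : Expr arity v
  nodeₑ : Expr arity v → Expr arity v → Expr arity v
  caseₑ : Expr arity v → Expr arity v → Expr arity (2 + v) → Expr arity v
  letₑ  : Expr arity v → Expr arity (1 + v) → Expr arity v
  callₑ : (f : Fin F) → Vec (Expr arity v) (arity f) → Expr arity v

record Program (inputs : ℕ) : Set where
  field
    {#funs} : ℕ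
    arity   : Fin #funs → ℕ
    body    : (f : Fin #funs) → Expr arity (arity f)
    main    : Expr arity inputs

module _ {F : ℕ} {arity : Fin F → ℕ}
         (body : (f : Fin F) → Expr arity (arity f)) where

  -- Call-by-value evaluation.  Eval body ρ e x t: in the environment ρ,
  -- the expression e evaluates to x in t steps.
  mutual

    data Eval {v : ℕ} (ρ : Vec Tree v) : Expr arity v → Tree → ℕ → Set where

      eval-var : ∀ {i} → Eval ρ (varₑ i) (lookup ρ i) 1

      eval-leaf : Eval ρ leafₑ leaf 1

      eval-node : ∀ {e₁ e₂ x₁ x₂ t₁ t₂} →
                  Eval ρ e₁ x₁ t₁ → Eval ρ e₂ x₂ t₂ →
                  Eval ρ (nodeₑ e₁ e₂) (node x₁ x₂) (1 + t₁ + t₂)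

      eval-case-leaf : ∀ {e e₁ e₂ y t₁ t₂} →
                       Eval ρ e leaf t₁ → Eval ρ e₁ y t₂ →
                       Eval ρ (caseₑ e e₁ e₂) y (1 + t₁ + t₂)

      eval-case-node : ∀ {e e₁ e₂ x₁ x₂ y t₁ t₂} →
                       Eval ρ e (node x₁ x₂) t₁ →
                       Eval (x₁ ∷ x₂ ∷ ρ) e₂ y t₂ →
                       Eval ρ (caseₑ e e₁ e₂) y (1 + t₁ + t₂)

      eval-let : ∀ {e₁ e₂ x y t₁ t₂} →
                 Eval ρ e₁ x t₁ → Eval (x ∷ ρ) e₂ y t₂ →
                 Eval ρ (letₑ e₁ e₂) y (1 + t₁ + t₂)

      eval-call : ∀ {f es xs y t₁ t₂} →
                  Evals ρ es xs t₁ → Eval xs (body f) y t₂ →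
                  Eval ρ (callₑ f es) y (1 + t₁ + t₂)

    data Evals {v : ℕ} (ρ : Vec Tree v) :
               ∀ {m} → Vec (Expr arity v) m → Vec Tree m → ℕ → Set where

      []  : Evals ρ [] [] 0

      _∷_ : ∀ {m e x t₁ t₂} {es : Vec (Expr arity v) m} {xs} →
            Eval ρ e x t₁ → Evals ρ es xs t₂ →
            Evals ρ (e ∷ es) (x ∷ xs) (t₁ + t₂)

-- On the given inputs, the program halts after t steps with output y.
Runs : ∀ {a} → Program a → Vec Tree a → Tree → ℕ → Set
Runs P xs y t = Eval (Program.body P) xs (Program.main P) y t

------------------------------------------------------------------------
-- Encoding of inputs and outputs

encodeBool : Bool → Tree
encodeBool false = leaf
encodeBool true  = node leaf leaf

encodeList : List Tree → Tree
encodeList []       = leaf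
encodeList (x ∷ xs) = node x (encodeList xs)

-- List of digits, least significant first.  ℕᵇ is bijective base 2, so
-- the length is logarithmic; true stands for the digit 1 and false for
-- the digit 2.
encodeℕᵇ : ℕᵇ → Tree
encodeℕᵇ zero     = leaf
encodeℕᵇ 2[1+ x ] = node (encodeBool false) (encodeℕᵇ x)
encodeℕᵇ 1+[2 x ] = node (encodeBool true) (encodeℕᵇ x)

encodeℕ : ℕ → Tree
encodeℕ k = encodeℕᵇ (fromℕ k)

-- Adjacency matrix, as a list of rows.
encodeGraph : ∀ {n} → Graph n → Tree
encodeGraph G =
  encodeList (tabulate λ u → encodeList (tabulate λ v → encodeBool (adj G u v)))

{-# OPTIONS --safe #-}
module Submission where

-- Call a vertex set mixed if some connected component of the graph induced on
-- it contains both a claw and a triangle; S is a solution exactly when the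
-- complement of S is not mixed (`unmixed⇒solution`, `solution⇒unmixed`).  Let
-- U be the set of the remaining vertices.  If U is mixed, take a claw J
-- centred at a, a triangle T containing x, and a walk in U from a to x, such
-- that the length D of the walk is least possible over all choices.  The
-- theorem rests on the fact that some smallest solution deletes one of the
-- seven corners of J and T, so that branching over them is safe.
--
-- The reason is an exchange argument.  Let p be an inner vertex of a walk of
-- length D from a to x, and s and t its neighbours on that walk.  Then p is in
-- no triangle, as p is closer to a than x is, and is not the centre of a claw,
-- as p is closer to x than a is.  A third neighbour v of p would give one or
-- the other, according to whether two of v, s, t are adjacent.  Hence the
-- inner vertices have no neighbours besides inner vertices, a and x
-- (`inner-neighbour`).  A solution S that contains no corner has to cut all
-- walks of length D, so it contains an inner vertex (`cut`), and replacing all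
-- inner vertices in S by the single vertex x gives a solution that is no larger
-- (`exchange`).  With x deleted, the inner vertices hang off a only, so
-- they connect nothing; they are in no triangle, and a claw that uses them is
-- centred at a, where J survives in any case.
--
-- A closest pair is found by brute force over seven vertices and over the
-- walk lengths i < n (longer walks can be shortened, `shorten`), with the
-- matrix of the walks of length i maintained by i multiplications by the
-- adjacency matrix.
--
-- To run this in the model of computation, the polynomial part is written as
-- a term of a small typed language whose only loops run over the vertices
-- (`_⊢_`).  Terms have a denotation and a time bound that depends on the
-- term and on n only and is polynomial in n (`cost-poly`).  They compile to
-- function tables, and the evaluation of a compiled term yields the encoding
-- of its denotation within that time (`sound`).  The search tree itself is a
-- hand-written recursion on the budget k in unary, analysed in `solve≤`; with
-- at most 7 branches of one less budget it takes 7 ^ k times a polynomial.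

open import Defs
open import Data.Bool using (Bool; true; false; if_then_else_)
open import Data.Bool.ListAction using (any)
open import Data.Fin using (Fin; zero; suc; toℕ; _↑ʳ_)
open import Data.Fin.Patterns using (0F; 1F; 2F; 3F; 4F)
open import Data.Fin.Properties using (_≟_; any?)
open import Data.Fin.Subset using (Subset; _∈_; _∉_; ∣_∣; ∁; _∪_; _─_; _-_; ⊥; ⁅_⁆)
open import Data.Fin.Subset.Properties using (_∈?_; ∣p∣≤n; ∣⊥∣≡0; ∪-identityˡ; ∣p∣≤∣x∷p∣; x∈⁅x⁆; x∈p∩q⁺; x∈p∪q⁺; x∈∁p⇒x∉p; x∉p⇒x∈∁p; p─⊥≡p; p─q⊆p; x∈p∧x∉q⇒x∈p─q; x∈p∧x≢y⇒x∈p-y; x∈p⇒∣p-x∣<∣p∣; p∩q≢∅⇒∣p─q∣<∣p∣)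
open import Data.List using (List; []; _∷_; _++_; length)
open import Data.List.Membership.Propositional using () renaming (_∈_ to _∈ˡ_)
open import Data.List.Membership.Propositional.Properties using (∈-++⁺ˡ; ∈-++⁺ʳ; ∈-++⁻; ∈-lookup)
open import Data.List.Properties using (tabulate-cong; map-cong)
open import Data.List.Relation.Binary.Subset.Propositional using () renaming (_⊆_ to _⊆ˡ_)
open import Data.List.Relation.Unary.All using (All; []; _∷_)
open import Data.List.Relation.Unary.Any using (Any; here; there; index)
open import Data.List.Relation.Unary.Any.Properties using (lookup-index; map⁺; map⁻)
open import Data.Nat using (ℕ; zero; suc; _+_; _*_; _^_; _≤_; _<_; z≤n; s≤s; z<s; s<s; NonZero; >-nonZero)
open import Data.Nat.Binary using (zero; 2[1+_]; 1+[2_]; fromℕ)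
open import Data.Nat.Binary.Properties using (toℕ-fromℕ)
open import Data.Nat.Properties hiding (_≟_)
open import Data.Nat.Tactic.RingSolver using (solve-∀)
open import Data.Product using (_×_; _,_; ∃-syntax; proj₁; proj₂)
open import Data.Sum using (_⊎_; inj₁; inj₂)
open import Data.Vec using (Vec; []; _∷_; toList; tabulate; lookup)
open import Data.Vec.Functional using (foldr)
open import Data.Vec.Properties using ([]=⇒lookup; lookup⇒[]=; lookup∘tabulate; tabulate∘lookup; map-∘; tabulate-∘; lookup-++ʳ; lookup-map)
open import Function using (_∘_; id; case_of_; mk⇔)
open import Function.Bundles using (Equivalence)
open import Function.Definitions using (Injective)
open import Relation.Binary.Construct.Closure.ReflexiveTransitive using (ε; _◅_)
open import Relation.Binary.PropositionalEquality using (_≡_; _≢_; refl; sym; trans; cong; cong₂; subst; ≢-sym)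
open import Relation.Nullary using (¬_; Dec; Reflects; ofʸ; ofⁿ; does; yes; no; contradiction; _×-dec_; ¬?)
open import Relation.Nullary.Decidable using (map′; dec-true; dec-false)
open import Relation.Unary using (Decidable)
import Data.Bool as Bool
import Data.List as List
import Data.List.Relation.Unary.All as All
import Data.List.Relation.Unary.All.Properties as Allₚ
import Data.List.Relation.Unary.Any as Any
import Data.Nat as Nat
import Data.Nat.Binary as Bin
import Data.Vec as Vec
import Data.Vec.Properties as Vecₚ

------------------------------------------------------------------------
-- Polynomial bounds

-- f is bounded by a monomial in n + 1, with the same constant as coefficient
-- and as exponent.
Poly : (ℕ → ℕ) → Set
Poly f = ∃[ c ] (∀ n → f n ≤ c * suc n ^ c)

poly-≤ : ∀ {f g} → (∀ n → f n ≤ g n) → Poly g → Poly f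
poly-≤ f≤g (c , h) = c , λ n → ≤-trans (f≤g n) (h n)

poly-const : ∀ k → Poly λ _ → k
poly-const k = k , λ n → ≤-trans (≤-reflexive (sym (*-identityʳ k))) (*-monoʳ-≤ k (m^n>0 (suc n) k))

poly-suc : Poly suc
poly-suc = 1 , λ n → ≤-reflexive (sym (trans (*-identityˡ _) (*-identityʳ _)))

poly-id : Poly λ n → n
poly-id = poly-≤ n≤1+n poly-suc

poly-+ : ∀ {f g} → Poly f → Poly g → Poly λ n → f n + g n
poly-+ {f} {g} (c , p) (d , q) = c + d , λ n → begin
    f n + g n                                 ≤⟨ +-mono-≤ (p n) (q n) ⟩
    c * suc n ^ c + d * suc n ^ d             ≤⟨ +-mono-≤ (*-monoʳ-≤ c (^-monoʳ-≤ (suc n) (m≤m+n c d)))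
                                                          (*-monoʳ-≤ d (^-monoʳ-≤ (suc n) (m≤n+m d c))) ⟩
    c * suc n ^ (c + d) + d * suc n ^ (c + d) ≡⟨ *-distribʳ-+ (suc n ^ (c + d)) c d ⟨
    (c + d) * suc n ^ (c + d)                 ∎
  where open ≤-Reasoning

poly-* : ∀ {f g} → Poly f → Poly g → Poly λ n → f n * g n
poly-* {f} {g} (c , p) (d , q) = c * d + (c + d) , λ n → begin
    f n * g n                                     ≤⟨ *-mono-≤ (p n) (q n) ⟩
    (c * suc n ^ c) * (d * suc n ^ d)             ≡⟨ interchange c d (suc n ^ c) (suc n ^ d) ⟩
    (c * d) * (suc n ^ c * suc n ^ d)             ≡⟨ cong (c * d *_) (^-distribˡ-+-* (suc n) c d) ⟨
    (c * d) * suc n ^ (c + d)                     ≤⟨ *-mono-≤ (m≤m+n (c * d) (c + d))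
                                                              (^-monoʳ-≤ (suc n) (m≤n+m (c + d) (c * d))) ⟩
    (c * d + (c + d)) * suc n ^ (c * d + (c + d)) ∎
  where
  open ≤-Reasoning
  interchange : ∀ c d x y → (c * x) * (d * y) ≡ (c * d) * (x * y)
  interchange = solve-∀

------------------------------------------------------------------------
-- A typed language of loops over the vertices

-- Types are interpreted relative to a number n: `fin` stands for the numbers
-- below n, and `vec` for vectors of length n.
data Ty : Set where
  bool fin : Ty
  vec list : Ty → Ty
  _⊗_      : Ty → Ty → Ty

Ctx : Set
Ctx = List Ty

infix 4 _⊢_

-- Terms with typed de Bruijn variables.  The vector variable of `tab` and
-- `fold` only serves as a loop counter: it has n entries, and the body sees
-- the current index (and, in `fold`, the result of the later iterations).
-- Lists can be built but not traversed, which is why running times depend on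
-- n only.
data _⊢_ (Γ : Ctx) : Ty → Set where
  var    : ∀ {τ} → τ ∈ˡ Γ → Γ ⊢ τ
  lit    : Bool → Γ ⊢ bool
  cond   : ∀ {τ} → Γ ⊢ bool → Γ ⊢ τ → Γ ⊢ τ → Γ ⊢ τ
  at     : ∀ {τ} → Γ ⊢ vec τ → Γ ⊢ fin → Γ ⊢ τ
  same   : Γ ⊢ fin → Γ ⊢ fin → Γ ⊢ bool
  tab    : ∀ {σ τ} → vec σ ∈ˡ Γ → fin ∷ Γ ⊢ τ → Γ ⊢ vec τ
  fold   : ∀ {σ τ} → vec σ ∈ˡ Γ → Γ ⊢ τ → fin ∷ τ ∷ Γ ⊢ τ → Γ ⊢ τ
  nil    : ∀ {τ} → Γ ⊢ list τ
  cons   : ∀ {τ} → Γ ⊢ τ → Γ ⊢ list τ → Γ ⊢ list τ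
  orElse : ∀ {τ} → Γ ⊢ list τ → Γ ⊢ list τ → Γ ⊢ list τ
  pair   : ∀ {σ τ} → Γ ⊢ σ → Γ ⊢ τ → Γ ⊢ σ ⊗ τ
  fst    : ∀ {σ τ} → Γ ⊢ σ ⊗ τ → Γ ⊢ σ
  snd    : ∀ {σ τ} → Γ ⊢ σ ⊗ τ → Γ ⊢ τ

Val : ℕ → Ty → Set
Val n bool     = Bool
Val n fin      = Fin n
Val n (vec τ)  = Vec (Val n τ) n
Val n (list τ) = List (Val n τ)
Val n (σ ⊗ τ)  = Val n σ × Val n τ

Env : ℕ → Ctx → Set
Env n = All (Val n)

infixr 5 _<∣>_

-- The first list, unless it is empty.
_<∣>_ : ∀ {A : Set} → List A → List A → List A
[]       <∣> ys = ys
(x ∷ xs) <∣> ys = x ∷ xs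

⟦_⟧ : ∀ {Γ τ} → Γ ⊢ τ → ∀ {n} → Env n Γ → Val n τ
⟦ var x ⟧      γ = All.lookup γ x
⟦ lit b ⟧      γ = b
⟦ cond c t e ⟧ γ = if ⟦ c ⟧ γ then ⟦ t ⟧ γ else ⟦ e ⟧ γ
⟦ at v i ⟧     γ = lookup (⟦ v ⟧ γ) (⟦ i ⟧ γ)
⟦ same i j ⟧   γ = does (⟦ i ⟧ γ ≟ ⟦ j ⟧ γ)
⟦ tab _ e ⟧    γ = tabulate λ i → ⟦ e ⟧ (i ∷ γ)
⟦ fold _ z e ⟧ γ = foldr (λ i y → ⟦ e ⟧ (i ∷ y ∷ γ)) (⟦ z ⟧ γ) id
⟦ nil ⟧        γ = []
⟦ cons e es ⟧  γ = ⟦ e ⟧ γ ∷ ⟦ es ⟧ γ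
⟦ orElse d e ⟧ γ = ⟦ d ⟧ γ <∣> ⟦ e ⟧ γ
⟦ pair d e ⟧   γ = ⟦ d ⟧ γ , ⟦ e ⟧ γ
⟦ fst e ⟧      γ = proj₁ (⟦ e ⟧ γ)
⟦ snd e ⟧      γ = proj₂ (⟦ e ⟧ γ)

unary : ℕ → Tree
unary zero    = leaf
unary (suc k) = node leaf (unary k)

enc : ∀ {n} τ → Val n τ → Tree
enc bool     b       = encodeBool b
enc fin      i       = unary (toℕ i)
enc (vec τ)  xs      = encodeList (List.map (enc τ) (toList xs))
enc (list τ) xs      = encodeList (List.map (enc τ) xs)
enc (σ ⊗ τ)  (x , y) = node (enc σ x) (enc τ y)

-- A bound on the number of evaluation steps of a compiled term.  For a
-- conditional the costs of the branches are added rather than compared.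
cost : ∀ {Γ τ} → Γ ⊢ τ → ℕ → ℕ
cost     (var x)      n = 1
cost     (lit b)      n = 3
cost     (cond c t e) n = 1 + cost c n + (cost t n + cost e n)
cost     (at v i)     n = 1 + (cost v n + (cost i n + 0)) + 7 * n
cost     (same i j)   n = 1 + (cost i n + (cost j n + 0)) + 7 * n
cost {Γ} (tab x e)    n = 3 + length Γ + suc n * (9 + length Γ + cost e n)
cost {Γ} (fold x z e) n = 3 + length Γ + suc n * (9 + length Γ + cost z n + cost e n)
cost     nil          n = 1
cost     (cons e es)  n = 1 + cost e n + cost es n
cost     (orElse d e) n = 1 + cost d n + (3 + cost e n)
cost     (pair d e)   n = 1 + cost d n + cost e n
cost     (fst e)      n = 2 + cost e n
cost     (snd e)      n = 2 + cost e n

cost-poly : ∀ {Γ τ} (e : Γ ⊢ τ) → Poly (cost e)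
cost-poly (var x)      = poly-const 1
cost-poly (lit b)      = poly-const 3
cost-poly (cond c t e) = poly-+ (poly-+ (poly-const 1) (cost-poly c)) (poly-+ (cost-poly t) (cost-poly e))
cost-poly (at v i)     =
  poly-+ (poly-+ (poly-const 1) (poly-+ (cost-poly v) (poly-+ (cost-poly i) (poly-const 0))))
         (poly-* (poly-const 7) poly-id)
cost-poly (same i j)   =
  poly-+ (poly-+ (poly-const 1) (poly-+ (cost-poly i) (poly-+ (cost-poly j) (poly-const 0))))
         (poly-* (poly-const 7) poly-id)
cost-poly {Γ} (tab x e) =
  poly-+ (poly-const (3 + length Γ)) (poly-* poly-suc (poly-+ (poly-const (9 + length Γ)) (cost-poly e)))
cost-poly {Γ} (fold x z e) =
  poly-+ (poly-const (3 + length Γ))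
         (poly-* poly-suc (poly-+ (poly-+ (poly-const (9 + length Γ)) (cost-poly z)) (cost-poly e)))
cost-poly nil          = poly-const 1
cost-poly (cons e es)  = poly-+ (poly-+ (poly-const 1) (cost-poly e)) (cost-poly es)
cost-poly (orElse d e) = poly-+ (poly-+ (poly-const 1) (cost-poly d)) (poly-+ (poly-const 3) (cost-poly e))
cost-poly (pair d e)   = poly-+ (poly-+ (poly-const 1) (cost-poly d)) (cost-poly e)
cost-poly (fst e)      = poly-+ (poly-const 2) (cost-poly e)
cost-poly (snd e)      = poly-+ (poly-const 2) (cost-poly e)

------------------------------------------------------------------------
-- Compilation to function tables

-- Specifications of functions; a program table is a list of these.  `atS` and
-- `sameS` look up a vector entry and compare indices, `tabS` and `foldS` are
-- the loops of the language, `unaryS` and `doubleS` convert the binary budget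
-- to unary, and `solveS` and `anyS` are the search tree for a given branching
-- term.
data Src : Set where
  atS sameS unaryS doubleS : Src
  tabS  : ∀ {Γ τ} → fin ∷ Γ ⊢ τ → Src
  foldS : ∀ {Γ τ} → Γ ⊢ τ → fin ∷ τ ∷ Γ ⊢ τ → Src
  solveS anyS : ∀ {α υ} → α ∷ υ ∷ [] ⊢ list υ → Src

-- The loops take the rest of the counting vector, the current index and the
-- values of all variables in scope.
srcArity : Src → ℕ
srcArity atS             = 2
srcArity sameS           = 2
srcArity unaryS          = 1
srcArity doubleS         = 1
srcArity (tabS {Γ} e)    = 2 + length Γ
srcArity (foldS {Γ} z e) = 2 + length Γ
srcArity (solveS e)      = 3
srcArity (anyS e)        = 3

-- All functions that the evaluation of a term may enter.
sources : ∀ {Γ τ} → Γ ⊢ τ → List Src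
sources (var x)      = []
sources (lit b)      = []
sources (cond c t e) = sources c ++ sources t ++ sources e
sources (at v i)     = atS ∷ sources v ++ sources i
sources (same i j)   = sameS ∷ sources i ++ sources j
sources (tab x e)    = tabS e ∷ sources e
sources (fold x z e) = foldS z e ∷ sources z ++ sources e
sources nil          = []
sources (cons e es)  = sources e ++ sources es
sources (orElse d e) = sources d ++ sources e
sources (pair d e)   = sources d ++ sources e
sources (fst e)      = sources e
sources (snd e)      = sources e

-- The functions that a function may enter, other than itself.
callees : Src → List Src
callees atS         = []
callees sameS       = []
callees unaryS      = doubleS ∷ []
callees doubleS     = []
callees (tabS e)    = sources e
callees (foldS z e) = sources z ++ sources e
callees (solveS e)  = anyS e ∷ sources e
callees (anyS e)    = solveS e ∷ []

module _ {A : Set} where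

  ⊆-left : ∀ {xs ys zs : List A} → xs ++ ys ⊆ˡ zs → xs ⊆ˡ zs
  ⊆-left inc = inc ∘ ∈-++⁺ˡ

  ⊆-right : ∀ xs {ys zs : List A} → xs ++ ys ⊆ˡ zs → ys ⊆ˡ zs
  ⊆-right xs inc = inc ∘ ∈-++⁺ʳ xs

  ∈-++-elim : ∀ {P : A → Set} xs {ys} → (∀ {s} → s ∈ˡ xs → P s) → (∀ {s} → s ∈ˡ ys → P s) →
              ∀ {s} → s ∈ˡ xs ++ ys → P s
  ∈-++-elim xs f g p with ∈-++⁻ xs p
  ... | inj₁ q = f q
  ... | inj₂ q = g q

mutual

  sources-closed : ∀ {Γ τ} (e : Γ ⊢ τ) {T} → sources e ⊆ˡ T → ∀ {s} → s ∈ˡ sources e → callees s ⊆ˡ T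
  sources-closed (cond c t e) inc = ∈-++-elim {P = λ s → callees s ⊆ˡ _} (sources c)
    (sources-closed c (⊆-left inc)) (sources-closed₂ t e (⊆-right (sources c) inc))
  sources-closed (at v i)     inc (here refl) = λ ()
  sources-closed (at v i)     inc (there p)   = sources-closed₂ v i (inc ∘ there) p
  sources-closed (same i j)   inc (here refl) = λ ()
  sources-closed (same i j)   inc (there p)   = sources-closed₂ i j (inc ∘ there) p
  sources-closed (tab x e)    inc (here refl) = inc ∘ there
  sources-closed (tab x e)    inc (there p)   = sources-closed e (inc ∘ there) p
  sources-closed (fold x z e) inc (here refl) = inc ∘ there
  sources-closed (fold x z e) inc (there p)   = sources-closed₂ z e (inc ∘ there) p
  sources-closed (cons e es)  = sources-closed₂ e es
  sources-closed (orElse d e) = sources-closed₂ d e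
  sources-closed (pair d e)   = sources-closed₂ d e
  sources-closed (fst e)      = sources-closed e
  sources-closed (snd e)      = sources-closed e

  sources-closed₂ : ∀ {Γ Δ σ τ} (d : Γ ⊢ σ) (e : Δ ⊢ τ) {T} → sources d ++ sources e ⊆ˡ T →
                    ∀ {s} → s ∈ˡ sources d ++ sources e → callees s ⊆ˡ T
  sources-closed₂ d e inc = ∈-++-elim {P = λ s → callees s ⊆ˡ _} (sources d)
    (sources-closed d (⊆-left inc)) (sources-closed e (⊆-right (sources d) inc))

-- The positions of the variables of Γ in a run-time environment of size w.
Ren : Ctx → ℕ → Set
Ren Γ w = Vec (Fin w) (length Γ)

_!_ : ∀ {Γ w τ} → Ren Γ w → τ ∈ˡ Γ → Fin w
r ! x = lookup r (index x)

pattern v0  = here refl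
pattern v1  = there v0
pattern v2  = there v1
pattern v3  = there v2
pattern v4  = there v3
pattern v5  = there v4
pattern v6  = there v5
pattern v7  = there v6
pattern v8  = there v7
pattern v9  = there v8
pattern v10 = there v9
pattern v11 = there v10
pattern v12 = there v11
pattern v13 = there v12
pattern v14 = there v13
pattern v15 = there v14
pattern v16 = there v15
pattern v17 = there v16

module Compile (table : List Src) where

  arity : Fin (length table) → ℕ
  arity f = srcArity (List.lookup table f)

  E : ℕ → Set
  E = Expr arity

  -- A call of the function s at its position in the table, where it has the
  -- required arity.
  call : ∀ {s w} → s ∈ˡ table → Vec (E w) (srcArity s) → E w
  call {w = w} p es = callₑ (index p) (subst (Vec (E w) ∘ srcArity) (lookup-index p) es)

  trueₑ : ∀ {w} → E w
  trueₑ = nodeₑ leafₑ leafₑ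

  litₑ : ∀ {w} → Bool → E w
  litₑ false = leafₑ
  litₑ true  = trueₑ

  vars : ∀ {w m} → Vec (Fin w) m → Vec (E w) m
  vars = Vec.map varₑ

  compile : ∀ {Γ τ w} (e : Γ ⊢ τ) → sources e ⊆ˡ table → Ren Γ w → E w
  compile (var x) inc r = varₑ (r ! x)
  compile (lit b) inc r = litₑ b
  compile (cond c t e) inc r =
    caseₑ (compile c (⊆-left inc) r)
          (compile e (⊆-right (sources t) (⊆-right (sources c) inc)) r)
          (compile t (⊆-left (⊆-right (sources c) inc)) (Vec.map (2 ↑ʳ_) r))
  compile (at v i) inc r =
    call (inc v0) (compile v (⊆-left (inc ∘ there)) r ∷ compile i (⊆-right (sources v) (inc ∘ there)) r ∷ [])
  compile (same i j) inc r =
    call (inc v0) (compile i (⊆-left (inc ∘ there)) r ∷ compile j (⊆-right (sources i) (inc ∘ there)) r ∷ [])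
  compile (tab x e)    inc r = call (inc v0) (varₑ (r ! x) ∷ leafₑ ∷ vars r)
  compile (fold x z e) inc r = call (inc v0) (varₑ (r ! x) ∷ leafₑ ∷ vars r)
  compile nil inc r = leafₑ
  compile (cons d e) inc r = nodeₑ (compile d (⊆-left inc) r) (compile e (⊆-right (sources d) inc) r)
  compile (orElse d e) inc r =
    caseₑ (compile d (⊆-left inc) r) (compile e (⊆-right (sources d) inc) r) (nodeₑ (varₑ 0F) (varₑ 1F))
  compile (pair d e) inc r = nodeₑ (compile d (⊆-left inc) r) (compile e (⊆-right (sources d) inc) r)
  compile (fst e) inc r = caseₑ (compile e inc r) leafₑ (varₑ 0F)
  compile (snd e) inc r = caseₑ (compile e inc r) leafₑ (varₑ 1F)

  -- The variables occupy the environment in order, behind k other values.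
  pos : ∀ {m} k → Vec (Fin (k + m)) m
  pos k = tabulate (k ↑ʳ_)

  -- The bodies, for a function s at the position `self` of the table.  The
  -- comments list the arguments from index 0 on; each case on a node puts the two
  -- subtrees, and each let the bound value, in front of them.
  compileSrc : ∀ s → s ∈ˡ table → callees s ⊆ˡ table → E (srcArity s)
  -- vector, index
  compileSrc atS self inc =
    caseₑ (varₑ 1F) (caseₑ (varₑ 0F) leafₑ (varₑ 0F))
                    (caseₑ (varₑ 2F) leafₑ (call self (varₑ 1F ∷ varₑ 3F ∷ [])))
  -- two indices
  compileSrc sameS self inc =
    caseₑ (varₑ 0F) (caseₑ (varₑ 1F) trueₑ leafₑ)
                    (caseₑ (varₑ 3F) leafₑ (call self (varₑ 3F ∷ varₑ 1F ∷ [])))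
  -- list of digits; the digit is a leaf for 2 and a node for 1
  compileSrc unaryS self inc =
    caseₑ (varₑ 0F) leafₑ (letₑ (call (inc v0) (call self (varₑ 1F ∷ []) ∷ []))
      (caseₑ (varₑ 1F) (nodeₑ leafₑ (nodeₑ leafₑ (varₑ 0F))) (nodeₑ leafₑ (varₑ 2F))))
  -- unary number
  compileSrc doubleS self inc =
    caseₑ (varₑ 0F) leafₑ (nodeₑ leafₑ (nodeₑ leafₑ (call self (varₑ 1F ∷ []))))
  -- rest of the vector, index, variables
  compileSrc (tabS e) self inc =
    caseₑ (varₑ 0F) leafₑ (nodeₑ (compile e inc (3F ∷ pos 4))
                                 (call self (varₑ 1F ∷ nodeₑ leafₑ (varₑ 3F) ∷ vars (pos 4))))
  -- rest of the vector, index, variables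
  compileSrc (foldS z e) self inc =
    caseₑ (varₑ 0F) (compile z (⊆-left inc) (pos 2))
      (letₑ (call self (varₑ 1F ∷ nodeₑ leafₑ (varₑ 3F) ∷ vars (pos 4)))
            (compile e (⊆-right (sources z) inc) (4F ∷ (0F ∷ pos 5))))
  -- instance, state of the search, budget in unary
  compileSrc (solveS e) self inc =
    caseₑ (compile e (inc ∘ there) (0F ∷ 1F ∷ [])) trueₑ
      (caseₑ (varₑ 4F) leafₑ (call (inc v0) (varₑ 4F ∷ nodeₑ (varₑ 2F) (varₑ 3F) ∷ varₑ 1F ∷ [])))
  -- instance, list of states, budget in unary
  compileSrc (anyS e) self inc =
    caseₑ (varₑ 1F) leafₑ (caseₑ (call (inc v0) (varₑ 2F ∷ varₑ 0F ∷ varₑ 4F ∷ []))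
                                 (call self (varₑ 2F ∷ varₑ 1F ∷ varₑ 4F ∷ []))
                                 trueₑ)

------------------------------------------------------------------------
-- Evaluation of compiled terms

module Semantics (table : List Src) (closed : ∀ {s} → s ∈ˡ table → callees s ⊆ˡ table) where

  open Compile table public

  body : ∀ f → E (arity f)
  body f = compileSrc (List.lookup table f) (∈-lookup f) (closed (∈-lookup f))

  -- Evaluation in at most the given number of steps.
  Eval≤ : ∀ {w} → Vec Tree w → E w → Tree → ℕ → Set
  Eval≤ ρ e y T = ∃[ t ] Eval body ρ e y t × t ≤ T

  Evals≤ : ∀ {w m} → Vec Tree w → Vec (E w) m → Vec Tree m → ℕ → Set
  Evals≤ ρ es ys T = ∃[ t ] Evals body ρ es ys t × t ≤ T

  var≤ : ∀ {w} {ρ : Vec Tree w} i → Eval≤ ρ (varₑ i) (lookup ρ i) 1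
  var≤ i = 1 , eval-var , ≤-refl

  leaf≤ : ∀ {w} {ρ : Vec Tree w} → Eval≤ ρ leafₑ leaf 1
  leaf≤ = 1 , eval-leaf , ≤-refl

  node≤ : ∀ {w} {ρ : Vec Tree w} {d e x y S T} → Eval≤ ρ d x S → Eval≤ ρ e y T →
          Eval≤ ρ (nodeₑ d e) (node x y) (1 + S + T)
  node≤ (_ , p , s) (_ , q , t) = _ , eval-node p q , s≤s (+-mono-≤ s t)

  caseLeaf≤ : ∀ {w} {ρ : Vec Tree w} {e d f y S T} → Eval≤ ρ e leaf S → Eval≤ ρ d y T →
              Eval≤ ρ (caseₑ e d f) y (1 + S + T)
  caseLeaf≤ (_ , p , s) (_ , q , t) = _ , eval-case-leaf p q , s≤s (+-mono-≤ s t)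

  caseNode≤ : ∀ {w} {ρ : Vec Tree w} {e d f x₁ x₂ y S T} →
              Eval≤ ρ e (node x₁ x₂) S → Eval≤ (x₁ ∷ x₂ ∷ ρ) f y T →
              Eval≤ ρ (caseₑ e d f) y (1 + S + T)
  caseNode≤ (_ , p , s) (_ , q , t) = _ , eval-case-node p q , s≤s (+-mono-≤ s t)

  let≤ : ∀ {w} {ρ : Vec Tree w} {d e x y S T} → Eval≤ ρ d x S → Eval≤ (x ∷ ρ) e y T →
         Eval≤ ρ (letₑ d e) y (1 + S + T)
  let≤ (_ , p , s) (_ , q , t) = _ , eval-let p q , s≤s (+-mono-≤ s t)

  []≤ : ∀ {w} {ρ : Vec Tree w} → Evals≤ ρ [] [] 0
  []≤ = 0 , [] , z≤n

  infixr 5 _∷≤_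

  _∷≤_ : ∀ {w m} {ρ : Vec Tree w} {e x S T} {es : Vec (E w) m} {xs} →
         Eval≤ ρ e x S → Evals≤ ρ es xs T → Evals≤ ρ (e ∷ es) (x ∷ xs) (S + T)
  (_ , p , s) ∷≤ (_ , q , t) = _ , p ∷ q , +-mono-≤ s t

  relax : ∀ {w} {ρ : Vec Tree w} {e y S T} → S ≤ T → Eval≤ ρ e y S → Eval≤ ρ e y T
  relax S≤T (t , p , t≤S) = t , p , ≤-trans t≤S S≤T

  -- The body of the function s evaluates to y on the arguments xs, whichever
  -- entries of the table the calls in the body refer to.
  SrcEval≤ : ∀ s → Vec Tree (srcArity s) → Tree → ℕ → Set
  SrcEval≤ s xs y T = ∀ (self : s ∈ˡ table) (inc : callees s ⊆ˡ table) → Eval≤ xs (compileSrc s self inc) y T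

  call≤ : ∀ {s w} {ρ : Vec Tree w} (p : s ∈ˡ table) {es xs y S T} → Evals≤ ρ es xs S → SrcEval≤ s xs y T →
          Eval≤ ρ (call p es) y (1 + S + T)
  call≤ {w = w} {ρ} p {y = y} {S} {T} = at-index (index p) (lookup-index p)
    where
    at-index : ∀ i {s} (eq : s ≡ List.lookup table i) {es xs} → Evals≤ ρ es xs S → SrcEval≤ s xs y T →
               Eval≤ ρ (callₑ i (subst (Vec (E w) ∘ srcArity) eq es)) y (1 + S + T)
    at-index i refl (_ , p , s) f with f (∈-lookup i) (closed (∈-lookup i))
    ... | _ , q , t = _ , eval-call p q , s≤s (+-mono-≤ s t)

  encEnv : ∀ {n Γ} → Env n Γ → Vec Tree (length Γ)
  encEnv []                = []
  encEnv (_∷_ {x = τ} v γ) = enc τ v ∷ encEnv γ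

  -- The run-time environment ρ holds the encodings of γ at the positions r.
  Agree : ∀ {n Γ w} → Ren Γ w → Env n Γ → Vec Tree w → Set
  Agree r γ ρ = Vec.map (lookup ρ) r ≡ encEnv γ

  lookup-encEnv : ∀ {n Γ τ} (γ : Env n Γ) (x : τ ∈ˡ Γ) →
                  lookup (encEnv γ) (index x) ≡ enc τ (All.lookup γ x)
  lookup-encEnv (v ∷ γ) (here refl) = refl
  lookup-encEnv (v ∷ γ) (there x)   = lookup-encEnv γ x

  agree-weaken : ∀ {n Γ w} (r : Ren Γ w) (γ : Env n Γ) {ρ s t} →
                 Agree r γ ρ → Agree (Vec.map (2 ↑ʳ_) r) γ (s ∷ t ∷ ρ)
  agree-weaken r γ a = trans (sym (map-∘ _ _ r)) a

  agree-pos : ∀ {n Γ k} (ts : Vec Tree k) (γ : Env n Γ) → Agree (pos k) γ (ts Vec.++ encEnv γ)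
  agree-pos {k = k} ts γ = trans (sym (tabulate-∘ _ _))
    (trans (Vecₚ.tabulate-cong (lookup-++ʳ ts (encEnv γ))) (tabulate∘lookup (encEnv γ)))

  var-≡ : ∀ {w} {ρ : Vec Tree w} {i y} → lookup ρ i ≡ y → Eval≤ ρ (varₑ i) y 1
  var-≡ refl = var≤ _

  var-agree : ∀ {n Γ τ w} (r : Ren Γ w) (γ : Env n Γ) {ρ} → Agree r γ ρ → (x : τ ∈ˡ Γ) →
              Eval≤ ρ (varₑ (r ! x)) (enc τ (All.lookup γ x)) 1
  var-agree r γ {ρ} a x = var-≡ (trans (sym (lookup-map (index x) (lookup ρ) r))
    (trans (cong (λ ys → lookup ys (index x)) a) (lookup-encEnv γ x)))

  vars≤ : ∀ {w m} {ρ : Vec Tree w} (r : Vec (Fin w) m) {ys} →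
          Vec.map (lookup ρ) r ≡ ys → Evals≤ ρ (vars r) ys m
  vars≤ []      refl = []≤
  vars≤ (i ∷ r) refl = var≤ i ∷≤ vars≤ r refl

  at≤ : ∀ {n} τ {m} (xs : Vec (Val n τ) m) i →
        SrcEval≤ atS (encodeList (List.map (enc τ) (toList xs)) ∷ unary (toℕ i) ∷ [])
                 (enc τ (lookup xs i)) (7 * m)
  at≤ τ {suc m} (x ∷ xs) zero    self inc = relax (≤-trans (m≤m+n 5 (2 + 7 * m)) (≤-reflexive (sym (*-suc 7 m))))
    (caseLeaf≤ (var≤ 1F) (caseNode≤ (var≤ 0F) (var≤ 0F)))
  at≤ τ {suc m} (x ∷ xs) (suc i) self inc = relax (≤-reflexive (sym (*-suc 7 m)))
    (caseNode≤ (var≤ 1F) (caseNode≤ (var≤ 2F) (call≤ self (var≤ 1F ∷≤ var≤ 3F ∷≤ []≤) (at≤ τ xs i))))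

  same≤ : ∀ {m} (i j : Fin m) →
          SrcEval≤ sameS (unary (toℕ i) ∷ unary (toℕ j) ∷ []) (encodeBool (does (i ≟ j))) (7 * m)
  same≤ {suc m} zero    zero    self inc = relax (≤-trans (m≤m+n 7 (7 * m)) (≤-reflexive (sym (*-suc 7 m))))
    (caseLeaf≤ (var≤ 0F) (caseLeaf≤ (var≤ 1F) (node≤ leaf≤ leaf≤)))
  same≤ {suc m} zero    (suc j) self inc = relax (≤-trans (m≤m+n 5 (2 + 7 * m)) (≤-reflexive (sym (*-suc 7 m))))
    (caseLeaf≤ (var≤ 0F) (caseNode≤ (var≤ 1F) leaf≤))
  same≤ {suc m} (suc i) zero    self inc = relax (≤-trans (m≤m+n 5 (2 + 7 * m)) (≤-reflexive (sym (*-suc 7 m))))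
    (caseNode≤ (var≤ 0F) (caseLeaf≤ (var≤ 3F) leaf≤))
  same≤ {suc m} (suc i) (suc j) self inc = relax (≤-reflexive (sym (*-suc 7 m)))
    (caseNode≤ (var≤ 0F) (caseNode≤ (var≤ 3F) (call≤ self (var≤ 3F ∷≤ var≤ 1F ∷≤ []≤) (same≤ i j))))

  mutual

    -- A compiled term evaluates to the encoding of its denotation.
    sound : ∀ {n Γ τ w} (e : Γ ⊢ τ) (inc : sources e ⊆ˡ table) (r : Ren Γ w) (γ : Env n Γ) {ρ} → Agree r γ ρ →
            Eval≤ ρ (compile e inc r) (enc τ (⟦ e ⟧ γ)) (cost e n)
    sound (var x) inc r γ a = var-agree r γ a x
    sound (lit false) inc r γ a = relax (s≤s z≤n) leaf≤
    sound (lit true) inc r γ a = node≤ leaf≤ leaf≤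
    sound {n} (cond c t e) inc r γ a
      with ⟦ c ⟧ γ | sound c (⊆-left inc) r γ a
    ... | false | c≤ = relax (+-monoʳ-≤ (1 + cost c n) (m≤n+m _ _))
                             (caseLeaf≤ c≤ (sound e _ r γ a))
    ... | true  | c≤ = relax (+-monoʳ-≤ (1 + cost c n) (m≤m+n _ _))
                             (caseNode≤ c≤ (sound t _ (Vec.map (2 ↑ʳ_) r) γ (agree-weaken r γ a)))
    sound (at {τ} v i) inc r γ a =
      call≤ (inc v0) (sound v _ r γ a ∷≤ sound i _ r γ a ∷≤ []≤) (at≤ τ (⟦ v ⟧ γ) (⟦ i ⟧ γ))
    sound (same i j) inc r γ a =
      call≤ (inc v0) (sound i _ r γ a ∷≤ sound j _ r γ a ∷≤ []≤) (same≤ (⟦ i ⟧ γ) (⟦ j ⟧ γ))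
    sound (tab {σ} x e) inc r γ a =
      call≤ (inc v0)
            (var-agree r γ a x ∷≤ leaf≤ ∷≤ vars≤ r a)
            (tab≤ σ e γ (All.lookup γ x) id 0 (λ j → sym (+-identityʳ (toℕ j))))
    sound (fold {σ} x z e) inc r γ a =
      call≤ (inc v0)
            (var-agree r γ a x ∷≤ leaf≤ ∷≤ vars≤ r a)
            (fold≤ σ z e γ (All.lookup γ x) id 0 (λ j → sym (+-identityʳ (toℕ j))))
    sound nil inc r γ a = leaf≤
    sound (cons d e) inc r γ a = node≤ (sound d _ r γ a) (sound e _ r γ a)
    sound {n} (orElse d e) inc r γ a
      with ⟦ d ⟧ γ | sound d (⊆-left inc) r γ a
    ... | []    | d≤ = relax (+-monoʳ-≤ (1 + cost d n) (m≤n+m _ 3)) (caseLeaf≤ d≤ (sound e _ r γ a))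
    ... | _ ∷ _ | d≤ = relax (+-monoʳ-≤ (1 + cost d n) (m≤m+n 3 _)) (caseNode≤ d≤ (node≤ (var≤ 0F) (var≤ 1F)))
    sound (pair d e) inc r γ a = node≤ (sound d _ r γ a) (sound e _ r γ a)
    sound {n} (fst e) inc r γ a = relax (≤-reflexive (cong suc (+-comm (cost e n) 1))) (caseNode≤ (sound e _ r γ a) (var≤ 0F))
    sound {n} (snd e) inc r γ a = relax (≤-reflexive (cong suc (+-comm (cost e n) 1))) (caseNode≤ (sound e _ r γ a) (var≤ 1F))

    -- The loops, for the last m indices; g enumerates these, starting at k.
    tab≤ : ∀ {n Γ τ} σ (e : fin ∷ Γ ⊢ τ) (γ : Env n Γ) {m} (xs : Vec (Val n σ) m) (g : Fin m → Fin n) k →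
           (∀ j → toℕ (g j) ≡ toℕ j + k) →
           SrcEval≤ (tabS e) (encodeList (List.map (enc σ) (toList xs)) ∷ unary k ∷ encEnv γ)
                    (encodeList (List.map (enc τ) (toList (tabulate λ j → ⟦ e ⟧ (g j ∷ γ)))))
                    (suc m * (9 + length Γ + cost e n))
    tab≤ σ e γ [] g k g≡ self inc = relax (s≤s (s≤s (s≤s z≤n))) (caseLeaf≤ (var≤ 0F) leaf≤)
    tab≤ {n} {Γ} σ e γ {suc m} (x ∷ xs) g k g≡ self inc =
      relax (≤-trans (n≤1+n _) (≤-reflexive (eq (length Γ) (cost e n) (suc m * (9 + length Γ + cost e n)))))
      (caseNode≤ (var≤ 0F)
        (node≤ (sound e _ (3F ∷ pos 4) (g zero ∷ γ)
                 (cong₂ _∷_ (cong unary (sym (g≡ zero))) (agree-pos (_ ∷ _ ∷ _ ∷ _ ∷ []) γ)))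
          (call≤ self (var≤ 1F ∷≤ node≤ leaf≤ (var≤ 3F) ∷≤ vars≤ (pos 4) (agree-pos (_ ∷ _ ∷ _ ∷ _ ∷ []) γ))
            (tab≤ σ e γ xs (g ∘ suc) (suc k) λ j → trans (g≡ (suc j)) (sym (+-suc (toℕ j) k))))))
      where
      eq : ∀ l c R → 1 + (1 + 1 + (1 + c + (1 + (1 + (3 + l)) + R))) ≡ (9 + l + c) + R
      eq = solve-∀

    fold≤ : ∀ {n Γ τ} σ (z : Γ ⊢ τ) (e : fin ∷ τ ∷ Γ ⊢ τ) (γ : Env n Γ) {m} (xs : Vec (Val n σ) m) (g : Fin m → Fin n) k →
            (∀ j → toℕ (g j) ≡ toℕ j + k) →
            SrcEval≤ (foldS z e) (encodeList (List.map (enc σ) (toList xs)) ∷ unary k ∷ encEnv γ)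
                     (enc τ (foldr (λ i y → ⟦ e ⟧ (i ∷ y ∷ γ)) (⟦ z ⟧ γ) g))
                     (suc m * (9 + length Γ + cost z n + cost e n))
    fold≤ {n} {Γ} σ z e γ [] g k g≡ self inc =
      relax (≤-trans (m≤m+n _ (7 + length Γ + cost e n)) (≤-reflexive (eq (length Γ) (cost z n) (cost e n))))
      (caseLeaf≤ (var≤ 0F) (sound z _ (pos 2) γ (agree-pos (_ ∷ _ ∷ []) γ)))
      where
      eq : ∀ l c d → 1 + 1 + c + (7 + l + d) ≡ (9 + l + c + d) + 0
      eq = solve-∀
    fold≤ {n} {Γ} σ z e γ {suc m} (x ∷ xs) g k g≡ self inc =
      relax (≤-trans (m≤m+n _ (1 + cost z n))
                     (≤-reflexive (eq (length Γ) (cost z n) (cost e n) (suc m * (9 + length Γ + cost z n + cost e n)))))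
      (caseNode≤ (var≤ 0F)
        (let≤ (call≤ self
                (var≤ 1F ∷≤ node≤ leaf≤ (var≤ 3F) ∷≤ vars≤ (pos 4) (agree-pos (_ ∷ _ ∷ _ ∷ _ ∷ []) γ))
                (fold≤ σ z e γ xs (g ∘ suc) (suc k) λ j → trans (g≡ (suc j)) (sym (+-suc (toℕ j) k))))
              (sound e _ (4F ∷ (0F ∷ pos 5)) (g zero ∷ _ ∷ γ)
                (cong₂ _∷_ (cong unary (sym (g≡ zero)))
                           (cong (_ ∷_) (agree-pos (_ ∷ _ ∷ _ ∷ _ ∷ _ ∷ []) γ))))))
      where
      eq : ∀ l c d R → 1 + 1 + (1 + (1 + (1 + (3 + l)) + R) + d) + (1 + c) ≡ (9 + l + c + d) + R
      eq = solve-∀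

------------------------------------------------------------------------
-- The search tree and its running time

-- Bounded search trees: f lists the branches of a state, a state without
-- branches is a success, and each branching uses up one unit of the budget.
mutual

  search : ∀ {A : Set} → (A → List A) → ℕ → A → Bool
  search f k u = continue f k (f u)

  continue : ∀ {A : Set} → (A → List A) → ℕ → List A → Bool
  continue f k       []       = true
  continue f zero    (_ ∷ _)  = false
  continue f (suc k) (v ∷ vs) = any (search f k) (v ∷ vs)

-- The cost of a search in which each state has at most b branches and costs D.
searchCost : ℕ → ℕ → ℕ → ℕ
searchCost b D zero    = D
searchCost b D (suc k) = D + b * searchCost b D k

searchCost-bound : ∀ {b} D k → 2 ≤ b → searchCost b D k ≤ b ^ k * (2 * D)
searchCost-bound {b} D k 2≤b = ≤-trans (m≤m+n _ D) (go k)
  where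
  open ≤-Reasoning
  -- The summand D on the left makes the induction go through.
  go : ∀ k → searchCost b D k + D ≤ b ^ k * (2 * D)
  go zero    = ≤-reflexive (eq D)
    where
    eq : ∀ D → D + D ≡ 1 * (2 * D)
    eq = solve-∀
  go (suc k) = begin
    D + b * searchCost b D k + D   ≡⟨ eq₁ D (b * searchCost b D k) ⟩
    b * searchCost b D k + 2 * D   ≤⟨ +-monoʳ-≤ (b * searchCost b D k) (*-monoˡ-≤ D 2≤b) ⟩
    b * searchCost b D k + b * D   ≡⟨ *-distribˡ-+ b _ D ⟨
    b * (searchCost b D k + D)     ≤⟨ *-monoʳ-≤ b (go k) ⟩
    b * (b ^ k * (2 * D))          ≡⟨ *-assoc b (b ^ k) (2 * D) ⟨
    b ^ suc k * (2 * D)            ∎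
    where
    eq₁ : ∀ D t → D + t + D ≡ t + 2 * D
    eq₁ = solve-∀

k≤b^k : ∀ {b} k → 2 ≤ b → k ≤ b ^ k
k≤b^k     zero    2≤b = z≤n
k≤b^k {b} (suc k) 2≤b = begin
    1 + k           ≤⟨ +-mono-≤ (m^n>0 b k) (k≤b^k k 2≤b) ⟩
    b ^ k + b ^ k   ≡⟨ cong (b ^ k +_) (+-identityʳ _) ⟨
    2 * b ^ k       ≤⟨ *-monoˡ-≤ (b ^ k) 2≤b ⟩
    b * b ^ k       ∎
  where
  open ≤-Reasoning
  instance
    b≢0 : NonZero b
    b≢0 = >-nonZero (≤-trans (s≤s z≤n) 2≤b)

-- The program that computes the root of the search tree from an instance (of
-- type α) and then searches with the given branching term, for states of type
-- υ.
module SearchProgram {α υ : Ty} (root : α ∷ [] ⊢ υ) (branch : α ∷ υ ∷ [] ⊢ list υ) where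

  table : List Src
  table = solveS branch ∷ anyS branch ∷ unaryS ∷ doubleS ∷ sources root ++ sources branch

  root⊆ : sources root ⊆ˡ table
  root⊆ p = there (there (there (there (∈-++⁺ˡ p))))

  branch⊆ : sources branch ⊆ˡ table
  branch⊆ p = there (there (there (there (∈-++⁺ʳ (sources root) p))))

  closed : ∀ {s} → s ∈ˡ table → callees s ⊆ˡ table
  closed (here refl)                         (here refl) = v1
  closed (here refl)                         (there p)   = branch⊆ p
  closed (there (here refl))                 (here refl) = v0
  closed (there (there (here refl)))         (here refl) = there (there v1)
  closed (there (there (there (here refl)))) = λ ()
  closed (there (there (there (there p))))   =
    ∈-++-elim {P = λ s → callees s ⊆ˡ table} (sources root) (sources-closed root root⊆) (sources-closed branch branch⊆) p

  open Semantics table closed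

  program : Program 2
  program = record
    { arity = arity
    ; body  = body
    ; main  = call {s = solveS branch} v0
                ( varₑ 0F
                ∷ compile root root⊆ (0F ∷ [])
                ∷ call {s = unaryS} (there v1) (varₑ 1F ∷ [])
                ∷ [])
    }

  double≤ : ∀ x → SrcEval≤ doubleS (unary x ∷ []) (unary (2 * x)) (3 + 8 * x)
  double≤ zero    self inc = caseLeaf≤ (var≤ 0F) leaf≤
  double≤ (suc x) self inc =
    subst (λ y → Eval≤ (unary (suc x) ∷ []) (compileSrc doubleS self inc) (unary y) (3 + 8 * suc x))
          (sym (*-suc 2 x))
    (relax (≤-reflexive (eq x))
      (caseNode≤ (var≤ 0F) (node≤ leaf≤ (node≤ leaf≤ (call≤ self (var≤ 1F ∷≤ []≤) (double≤ x))))))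
    where
    eq : ∀ x → 8 + (3 + 8 * x) ≡ 3 + 8 * suc x
    eq = solve-∀

  unary≤ : ∀ x → SrcEval≤ unaryS (encodeℕᵇ x ∷ []) (unary (Bin.toℕ x)) (3 + 16 * Bin.toℕ x)
  unary≤ zero     self inc = caseLeaf≤ (var≤ 0F) leaf≤
  unary≤ 2[1+ x ] self inc =
    subst (λ y → Eval≤ (encodeℕᵇ 2[1+ x ] ∷ []) (compileSrc unaryS self inc) (unary y) (3 + 16 * Bin.toℕ 2[1+ x ]))
          (sym (*-suc 2 (Bin.toℕ x)))
    (relax (≤-trans (m≤m+n _ (16 + 8 * Bin.toℕ x)) (≤-reflexive (eq (Bin.toℕ x))))
      (caseNode≤ (var≤ 0F)
        (let≤ (call≤ (inc v0) (call≤ self (var≤ 1F ∷≤ []≤) (unary≤ x) ∷≤ []≤) (double≤ (Bin.toℕ x)))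
              (caseLeaf≤ (var≤ 1F) (node≤ leaf≤ (node≤ leaf≤ (var≤ 0F)))))))
    where
    eq : ∀ x → 2 + (1 + (1 + (2 + (3 + 16 * x) + 0) + (3 + 8 * x)) + 7) + (16 + 8 * x) ≡ 3 + 16 * (2 * suc x)
    eq = solve-∀
  unary≤ 1+[2 x ] self inc =
    relax (≤-trans (m≤m+n _ (2 + 8 * Bin.toℕ x)) (≤-reflexive (eq (Bin.toℕ x))))
      (caseNode≤ (var≤ 0F)
        (let≤ (call≤ (inc v0) (call≤ self (var≤ 1F ∷≤ []≤) (unary≤ x) ∷≤ []≤) (double≤ (Bin.toℕ x)))
              (caseNode≤ (var≤ 1F) (node≤ leaf≤ (var≤ 2F)))))
    where
    eq : ∀ x → 2 + (1 + (1 + (2 + (3 + 16 * x) + 0) + (3 + 8 * x)) + 5) + (2 + 8 * x) ≡ 3 + 16 * suc (2 * x)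
    eq = solve-∀

  -- The cost of a state with at most b branches, apart from the searches below:
  -- the evaluation of the branching term, and 11 steps to traverse each branch.
  nodeCost : ℕ → ℕ → ℕ
  nodeCost b n = 12 + cost branch n + 11 * b

  module _ {n b : ℕ} (a : Val n α) (≤b : ∀ u → length (⟦ branch ⟧ (a ∷ u ∷ [])) ≤ b) where

    private

      f : Val n υ → List (Val n υ)
      f u = ⟦ branch ⟧ (a ∷ u ∷ [])

      T : ℕ → ℕ
      T = searchCost b (nodeCost b n)

    mutual

      solve≤ : ∀ k u → SrcEval≤ (solveS branch) (enc α a ∷ enc υ u ∷ unary k ∷ [])
                                (encodeBool (search f k u)) (T k)
      solve≤ k u self inc
        with f u | ≤b u
           | sound branch (inc ∘ there) (0F ∷ 1F ∷ []) (a ∷ u ∷ []) {enc α a ∷ enc υ u ∷ unary k ∷ []} refl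
      solve≤ zero u self inc | [] | _ | e≤ = relax
        (≤-trans (m≤m+n _ (8 + 11 * b)) (≤-reflexive (eq (cost branch n) b)))
        (caseLeaf≤ e≤ (node≤ leaf≤ leaf≤))
        where
        eq : ∀ c b → 1 + c + 3 + (8 + 11 * b) ≡ 12 + c + 11 * b
        eq = solve-∀
      solve≤ (suc k) u self inc | [] | _ | e≤ = relax
        (≤-trans (m≤m+n _ (8 + 11 * b + b * T k)) (≤-reflexive (eq (cost branch n) b (b * T k))))
        (caseLeaf≤ e≤ (node≤ leaf≤ leaf≤))
        where
        eq : ∀ c b t → 1 + c + 3 + (8 + 11 * b + t) ≡ 12 + c + 11 * b + t
        eq = solve-∀
      solve≤ zero u self inc | v ∷ vs | _ | e≤ = relax
        (≤-trans (m≤m+n _ (8 + 11 * b)) (≤-reflexive (eq (cost branch n) b)))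
        (caseNode≤ e≤ (caseLeaf≤ (var≤ 4F) leaf≤))
        where
        eq : ∀ c b → 1 + c + 3 + (8 + 11 * b) ≡ 12 + c + 11 * b
        eq = solve-∀
      solve≤ (suc k) u self inc | v ∷ vs | l≤b | e≤ = relax
        (≤-trans (+-monoʳ-≤ (1 + cost branch n) (+-monoʳ-≤ 8 (+-monoʳ-≤ 3 (*-monoˡ-≤ (11 + T k) l≤b))))
                 (≤-reflexive (eq (cost branch n) b (T k))))
        (caseNode≤ e≤ (caseNode≤ (var≤ 4F)
          (call≤ (inc v0) (var≤ 4F ∷≤ node≤ (var≤ 2F) (var≤ 3F) ∷≤ var≤ 1F ∷≤ []≤) (any≤ k (v ∷ vs)))))
        where
        eq : ∀ c b t → 1 + c + (8 + (3 + b * (11 + t))) ≡ 12 + c + 11 * b + b * t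
        eq = solve-∀

      any≤ : ∀ k us → SrcEval≤ (anyS branch) (enc α a ∷ enc (list υ) us ∷ unary k ∷ [])
                               (encodeBool (any (search f k) us)) (3 + length us * (11 + T k))
      any≤ k []       self inc = caseLeaf≤ (var≤ 1F) leaf≤
      any≤ k (u ∷ us) self inc
        with search f k u
           | call≤ {ρ = enc υ u ∷ enc (list υ) us ∷ enc α a ∷ enc (list υ) (u ∷ us) ∷ unary k ∷ []} (inc v0)
                   (var≤ 2F ∷≤ var≤ 0F ∷≤ var≤ 4F ∷≤ []≤) (solve≤ k u)
      ... | true  | u≤ = relax
        (≤-trans (m≤m+n _ (4 + length us * (11 + T k))) (≤-reflexive (eq (T k) (length us * (11 + T k)))))
        (caseNode≤ (var≤ 1F) (caseNode≤ u≤ (node≤ leaf≤ leaf≤)))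
        where
        eq : ∀ t l → 2 + (1 + (4 + t) + 3) + (4 + l) ≡ 3 + ((11 + t) + l)
        eq = solve-∀
      ... | false | u≤ = relax (≤-reflexive (eq (T k) (length us * (11 + T k))))
        (caseNode≤ (var≤ 1F) (caseLeaf≤ u≤ (call≤ self (var≤ 2F ∷≤ var≤ 1F ∷≤ var≤ 4F ∷≤ []≤) (any≤ k us))))
        where
        eq : ∀ t l → 2 + (1 + (4 + t) + (4 + (3 + l))) ≡ 3 + ((11 + t) + l)
        eq = solve-∀

    program≤ : ∀ k → Eval≤ (enc α a ∷ encodeℕ k ∷ []) (Program.main program)
                           (encodeBool (search f k (⟦ root ⟧ (a ∷ []))))
                           (7 + cost root n + 16 * k + T k)
    program≤ k = relax (≤-reflexive (eq (cost root n) k (T k)))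
      (call≤ v0
        (var≤ 0F
         ∷≤ sound root root⊆ (0F ∷ []) (a ∷ []) refl
         ∷≤ call≤ (there v1) (var≤ 1F ∷≤ []≤)
              (subst (λ m → SrcEval≤ unaryS (encodeℕ k ∷ []) (unary m) (3 + 16 * m)) (toℕ-fromℕ k) (unary≤ (fromℕ k)))
         ∷≤ []≤)
        (solve≤ k (⟦ root ⟧ (a ∷ []))))
      where
      eq : ∀ s k t → 1 + (1 + (s + (2 + (3 + 16 * k) + 0))) + t ≡ 7 + s + 16 * k + t
      eq = solve-∀

  -- The whole program takes at most b ^ k times this.
  overhead : ℕ → ℕ → ℕ
  overhead b n = 23 + cost root n + 2 * nodeCost b n

  -- Abstract, so that the type checker never computes the constant.
  abstract

    overhead-poly : ∀ b → Poly (overhead b)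
    overhead-poly b = poly-+ (poly-+ (poly-const 23) (cost-poly root))
      (poly-* (poly-const 2) (poly-+ (poly-+ (poly-const 12) (cost-poly branch)) (poly-const (11 * b))))

  total≤ : ∀ {b} n k → 2 ≤ b →
           7 + cost root n + 16 * k + searchCost b (nodeCost b n) k ≤ b ^ k * overhead b n
  total≤ {b} n k 2≤b = begin
      7 + cost root n + 16 * k + searchCost b (nodeCost b n) k
        ≤⟨ +-mono-≤ (+-mono-≤ (m≤m*n (7 + cost root n) (b ^ k)) (*-monoʳ-≤ 16 (k≤b^k k 2≤b)))
                    (searchCost-bound {b} (nodeCost b n) k 2≤b) ⟩
      (7 + cost root n) * b ^ k + 16 * b ^ k + b ^ k * (2 * nodeCost b n)
        ≡⟨ eq (b ^ k) (cost root n) (2 * nodeCost b n) ⟩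
      b ^ k * overhead b n ∎
    where
    open ≤-Reasoning
    instance
      b^k≢0 : NonZero (b ^ k)
      b^k≢0 = m^n≢0 b k {{>-nonZero (≤-trans (s≤s z≤n) 2≤b)}}
    eq : ∀ p s d → (7 + s) * p + 16 * p + p * d ≡ p * (23 + s + d)
    eq = solve-∀

  -- The program computes the answer of the search, in time b ^ k times a
  -- polynomial if every state has at most b branches.
  runs : ∀ {b} → 2 ≤ b →
    ∃[ c ] (∀ {n} (a : Val n α) → (∀ u → length (⟦ branch ⟧ (a ∷ u ∷ [])) ≤ b) → ∀ k →
      ∃[ t ] Runs program (enc α a ∷ encodeℕ k ∷ [])
                  (encodeBool (search (λ u → ⟦ branch ⟧ (a ∷ u ∷ [])) k (⟦ root ⟧ (a ∷ [])))) t
             × t ≤ b ^ k * (c * suc n ^ c))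
  runs {b} 2≤b = proj₁ (overhead-poly b) , λ {n} a ≤b k →
    let t , r , t≤ = program≤ {n} {b} a ≤b k
    in  t , r , ≤-trans t≤ (≤-trans (total≤ {b} n k 2≤b) (*-monoʳ-≤ (b ^ k) (proj₂ (overhead-poly b) n)))

------------------------------------------------------------------------
-- Sets of vertices, walks, claws and triangles

x∈p─q⇒x∉q : ∀ {n} {x : Fin n} (p q : Subset n) → x ∈ p ─ q → x ∉ q
x∈p─q⇒x∉q (_ ∷ p) (_ ∷ q) (Vec.there x∈) (Vec.there x∈q) = x∈p─q⇒x∉q p q x∈ x∈q

x∈p-y⇒x≢y : ∀ {n} {x y : Fin n} (p : Subset n) → x ∈ p - y → x ≢ y
x∈p-y⇒x≢y {y = y} p x∈ refl = x∈p─q⇒x∉q p ⁅ y ⁆ x∈ (x∈⁅x⁆ y)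

∣⁅x⁆∪p∣≤1+∣p∣ : ∀ {n} (x : Fin n) (p : Subset n) → ∣ ⁅ x ⁆ ∪ p ∣ ≤ suc ∣ p ∣
∣⁅x⁆∪p∣≤1+∣p∣ zero    (s ∷ p)     = s≤s (≤-trans (≤-reflexive (cong ∣_∣ (∪-identityˡ p))) (∣p∣≤∣x∷p∣ s p))
∣⁅x⁆∪p∣≤1+∣p∣ (suc x) (true ∷ p)  = s≤s (∣⁅x⁆∪p∣≤1+∣p∣ x p)
∣⁅x⁆∪p∣≤1+∣p∣ (suc x) (false ∷ p) = ∣⁅x⁆∪p∣≤1+∣p∣ x p

-- The set of the vertices with a decidable property.
module _ {n : ℕ} {P : Fin n → Set} (P? : Decidable P) where

  comprehension : Subset n
  comprehension = tabulate λ v → does (P? v)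

  ∈-comprehension⁺ : ∀ {v} → P v → v ∈ comprehension
  ∈-comprehension⁺ {v} p = lookup⇒[]= v _ (trans (lookup∘tabulate _ v) (dec-true (P? v) p))

  ∈-comprehension⁻ : ∀ {v} → v ∈ comprehension → P v
  ∈-comprehension⁻ {v} v∈ with P? v | trans (sym (lookup∘tabulate (λ v → does (P? v)) v)) ([]=⇒lookup v∈)
  ... | yes p | _ = p
  ... | no _  | ()

module GraphTheory {n : ℕ} (G : Graph n) where

  Adj : Fin n → Fin n → Set
  Adj u v = adj G u v ≡ true

  adj-flip : ∀ {u v} b → adj G u v ≡ b → adj G v u ≡ b
  adj-flip b e = trans (adj-sym G _ _) e

  adj-≢ : ∀ {u v} → Adj u v → u ≢ v
  adj-≢ {u} e refl = contradiction (trans (sym e) (adj-irrefl G u)) λ ()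

  -- Walks of the given length, all of whose vertices satisfy W.
  data Walk (W : Fin n → Set) : ℕ → Fin n → Fin n → Set where
    stop : ∀ {u} → W u → Walk W 0 u u
    step : ∀ {i u v w} → W u → Adj u v → Walk W i v w → Walk W (suc i) u w

  module _ {W : Fin n → Set} where

    origin : ∀ {i u v} → Walk W i u v → W u
    origin (stop Wu)     = Wu
    origin (step Wu _ _) = Wu

    _⁀_ : ∀ {i j u v w} → Walk W i u v → Walk W j v w → Walk W (i + j) u w
    stop _      ⁀ q = q
    step Wu e p ⁀ q = step Wu e (p ⁀ q)

    reverse : ∀ {i u v} → Walk W i u v → Walk W i v u
    reverse p = subst (λ i → Walk W i _ _) (+-identityʳ _) (go p (stop (origin p)))
      where
      go : ∀ {i j u v w} → Walk W i u v → Walk W j u w → Walk W (i + j) v w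
      go (stop _) q = q
      go {suc i} {j} {v = v} {w} (step _ e p) q =
        subst (λ k → Walk W k v w) (+-suc i j) (go p (step (origin p) (adj-flip true e) q))

    walk-map : ∀ {W′ : Fin n → Set} → (∀ {v} → W v → W′ v) → ∀ {i u v} → Walk W i u v → Walk W′ i u v
    walk-map f (stop Wu)     = stop (f Wu)
    walk-map f (step Wu e p) = step (f Wu) e (walk-map f p)

    walk? : Decidable W → ∀ i u v → Dec (Walk W i u v)
    walk? W? zero u v with u ≟ v | W? u
    ... | yes refl | yes Wu = yes (stop Wu)
    ... | yes refl | no ¬Wu = no λ { (stop Wu) → ¬Wu Wu }
    ... | no u≢v   | _      = no λ { (stop _) → u≢v refl }
    walk? W? (suc i) u v = map′
      (λ { (Wu , _ , e , p) → step Wu e p }) (λ { (step Wu e p) → Wu , _ , e , p })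
      (W? u ×-dec any? λ w → (adj G u w Bool.≟ true) ×-dec walk? W? i w v)

  -- A walk to v can be cut off at its last visit to u.
  avoidStart : ∀ {U : Subset n} {u i w v} → u ≢ v → Walk (_∈ U) i w v →
               (∃[ j ] Walk (_∈ U - u) j w v) ⊎ (∃[ w′ ] ∃[ j ] Adj u w′ × Walk (_∈ U - u) j w′ v)
  avoidStart u≢v (stop w∈) = inj₁ (_ , stop (x∈p∧x≢y⇒x∈p-y w∈ (≢-sym u≢v)))
  avoidStart {u = u} {w = w} u≢v (step w∈ e p) with avoidStart u≢v p
  ... | inj₂ q = inj₂ q
  ... | inj₁ (j , q) with w ≟ u
  ... | yes refl = inj₂ (_ , j , e , q)
  ... | no w≢u   = inj₁ (_ , step (x∈p∧x≢y⇒x∈p-y w∈ w≢u) e q)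

  -- Vertices joined by a walk are joined by one that is shorter than the number
  -- of vertices: leave the start for good and proceed in the remaining graph.
  shorten : ∀ m {U : Subset n} → ∣ U ∣ ≤ m → ∀ {i u v} → Walk (_∈ U) i u v → ∃[ j ] j < m × Walk (_∈ U) j u v
  shorten zero    ∣U∣≤0 p = contradiction (≤-trans (x∈p⇒∣p-x∣<∣p∣ (origin p)) ∣U∣≤0) n≮0
  shorten (suc m) {U} ∣U∣≤m {u = u} {v} p with u ≟ v
  ... | yes refl = 0 , z<s , stop (origin p)
  ... | no u≢v with avoidStart u≢v p
  ... | inj₁ (_ , q) = contradiction refl (x∈p-y⇒x≢y U (origin q))
  ... | inj₂ (w , _ , e , q) with shorten m (≤-pred (≤-trans (x∈p⇒∣p-x∣<∣p∣ (origin p)) ∣U∣≤m)) q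
  ... | j , j<m , r = suc j , s<s j<m , step (origin p) e (walk-map (p─q⊆p U ⁅ u ⁆) r)

  IsClaw : (a b c d : Fin n) → Set
  IsClaw a b c d = (Adj a b × Adj a c × Adj a d)
                 × (adj G b c ≡ false × adj G b d ≡ false × adj G c d ≡ false)
                 × (b ≢ c × b ≢ d × c ≢ d)

  IsTriangle : (x y z : Fin n) → Set
  IsTriangle x y z = Adj x y × Adj x z × Adj y z

  -- A claw with vertices in W and centre a.
  Claw : (Fin n → Set) → Fin n → Set
  Claw W a = ∃[ b ] ∃[ c ] ∃[ d ] All W (a ∷ b ∷ c ∷ d ∷ []) × IsClaw a b c d

  -- A triangle with vertices in W, one of them x.
  Triangle : (Fin n → Set) → Fin n → Set
  Triangle W x = ∃[ y ] ∃[ z ] All W (x ∷ y ∷ z ∷ []) × IsTriangle x y z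

  centre∈ : ∀ {W a} → Claw W a → W a
  centre∈ (_ , _ , _ , Wa ∷ _ , _) = Wa

  corner∈ : ∀ {W x} → Triangle W x → W x
  corner∈ (_ , _ , Wx ∷ _ , _) = Wx

  -- A walk of length i from the centre of a claw to a vertex of a triangle.
  Obstructed : (Fin n → Set) → ℕ → Set
  Obstructed W i = ∃[ a ] ∃[ x ] Claw W a × Triangle W x × Walk W i a x

  -- Some component of the graph induced on W contains a claw and a triangle.
  Mixed : (Fin n → Set) → Set
  Mixed W = ∃[ i ] Obstructed W i

  claw-map : ∀ {W W′ : Fin n → Set} → (∀ {v} → W v → W′ v) → ∀ {a} → Claw W a → Claw W′ a
  claw-map f (b , c , d , J∈ , J) = b , c , d , All.map f J∈ , J

  triangle-map : ∀ {W W′ : Fin n → Set} → (∀ {v} → W v → W′ v) → ∀ {x} → Triangle W x → Triangle W′ x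
  triangle-map f (y , z , T∈ , T) = y , z , All.map f T∈ , T

  mixed-map : ∀ {W W′ : Fin n → Set} → (∀ {v} → W v → W′ v) → Mixed W → Mixed W′
  mixed-map f (i , a , x , J , T , p) = i , a , x , claw-map f J , triangle-map f T , walk-map f p

  triangle-rotate : ∀ {x y z} → IsTriangle x y z → IsTriangle y z x
  triangle-rotate (xy , xz , yz) = yz , adj-flip true xy , adj-flip true xz

  claw? : ∀ {W} → Decidable W → Decidable (Claw W)
  claw? W? a = any? λ b → any? λ c → any? λ d → All.all? W? _ ×-dec
    ((adj G a b Bool.≟ true ×-dec adj G a c Bool.≟ true ×-dec adj G a d Bool.≟ true)
     ×-dec (adj G b c Bool.≟ false ×-dec adj G b d Bool.≟ false ×-dec adj G c d Bool.≟ false)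
     ×-dec (¬? (b ≟ c) ×-dec ¬? (b ≟ d) ×-dec ¬? (c ≟ d)))

------------------------------------------------------------------------
-- The exchange argument

  -- A closest pair of a claw and a triangle in U.
  module Exchange {U : Fin n → Set} (U? : Decidable U) {a x : Fin n} {D : ℕ}
                  (claw-a : Claw U a) (triangle-x : Triangle U x) (walk-ax : Walk U D a x)
                  (closest : ∀ {i} → Obstructed U i → D ≤ i) where

    -- The inner vertices of the walks of length D from a to x.  The bounds on i
    -- and j follow from the equation; they make the property decidable by search.
    Inner : Fin n → Set
    Inner p = ∃[ i ] i < D × ∃[ j ] j < D × suc i + suc j ≡ D × Walk U (suc i) p a × Walk U (suc j) p x

    inner : ∀ {p} i j → suc i + suc j ≡ D → Walk U (suc i) p a → Walk U (suc j) p x → Inner p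
    inner i j eq q r =
      i , subst (i <_) eq (m≤m+n (suc i) (suc j)) , j , subst (j <_) eq (m≤n+m (suc j) (suc i)) , eq , q , r

    inner? : Decidable Inner
    inner? p = anyUpTo? (λ i → anyUpTo? (λ j →
      (suc i + suc j Nat.≟ D) ×-dec walk? U? (suc i) p a ×-dec walk? U? (suc j) p x) D) D

    inner-∉-triangle : ∀ {p} → Inner p → ¬ Triangle U p
    inner-∉-triangle (i , _ , j , _ , refl , q , _) T =
      <⇒≱ (m<m+n (suc i) z<s) (closest (a , _ , claw-a , T , reverse q))

    inner-∉-centre : ∀ {p} → Inner p → ¬ Claw U p
    inner-∉-centre (i , _ , j , _ , refl , _ , r) J =
      <⇒≱ (s≤s (m≤n+m (suc j) i)) (closest (_ , x , J , triangle-x , r))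

    -- The neighbours of an inner vertex p on a walk of length D.
    towards-a : ∀ {p v} i j → suc i + suc j ≡ D → Adj p v → Walk U i v a → Walk U (suc j) p x →
                Inner v ⊎ v ≡ a ⊎ v ≡ x
    towards-a zero    j eq e (stop _) r = inj₂ (inj₁ refl)
    towards-a (suc i) j eq e q        r = inj₁
      (inner i (suc j) (trans (cong suc (+-suc i (suc j))) eq) q (step (origin q) (adj-flip true e) r))

    towards-x : ∀ {p v} i j → suc i + suc j ≡ D → Adj p v → Walk U (suc i) p a → Walk U j v x →
                Inner v ⊎ v ≡ a ⊎ v ≡ x
    towards-x i zero    eq e q (stop _) = inj₂ (inj₂ refl)
    towards-x i (suc j) eq e q r        = inj₁
      (inner (suc i) j (trans (cong suc (sym (+-suc i (suc j)))) eq) (step (origin r) (adj-flip true e) q) r)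

    inner-neighbour : ∀ {p v} → Inner p → U v → Adj p v → Inner v ⊎ v ≡ a ⊎ v ≡ x
    inner-neighbour {p} {v} P@(i , _ , j , _ , eq , step {v = s} Up ps q , step {v = t} _ pt r) Uv pv
      with v ≟ s | v ≟ t
    ... | yes refl | _        = towards-a i j eq ps q (step Up pt r)
    ... | no _     | yes refl = towards-x i j eq pt (step Up ps q) r
    ... | no v≢s   | no v≢t with adj G v s in vs | adj G v t in vt | adj G s t in st
    ... | true  | _     | _     =
      contradiction (v , s , (Up ∷ Uv ∷ origin q ∷ []) , (pv , ps , vs)) (inner-∉-triangle P)
    ... | false | true  | _     =
      contradiction (v , t , (Up ∷ Uv ∷ origin r ∷ []) , (pv , pt , vt)) (inner-∉-triangle P)
    ... | false | false | true  =
      contradiction (s , t , (Up ∷ origin q ∷ origin r ∷ []) , (ps , pt , st)) (inner-∉-triangle P)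
    ... | false | false | false =
      contradiction (v , s , t , (Up ∷ Uv ∷ origin q ∷ origin r ∷ [])
                    , (pv , ps , pt) , (vs , vt , st) , (v≢s , v≢t , s≢t)) (inner-∉-centre P)
      where
      -- Otherwise there is a walk of length D - 2 from a to x through s.
      s≢t : s ≢ t
      s≢t refl = <⇒≱ shortcut (closest (a , x , claw-a , triangle-x , (reverse q ⁀ r)))
        where
        shortcut : i + j < D
        shortcut = subst (i + j <_) eq (s≤s (+-monoʳ-≤ i (n≤1+n j)))

    -- A solution S that contains neither a corner of the claw at a nor one of the
    -- triangle at x.
    module _ (S : Subset n)
             (claw-kept : Claw (λ v → U v × v ∉ S) a) (triangle-kept : Triangle (λ v → U v × v ∉ S) x)
             (unmixed : ¬ Mixed (λ v → U v × v ∉ S)) where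

      private
        -- W′ is what remains when the inner vertices of S are exchanged for x.
        W W′ : Fin n → Set
        W  v = U v × v ∉ S
        W′ v = (U v × v ≢ x) × (v ∈ S → Inner v)

        outer : ∀ {v} → W′ v → ¬ Inner v → W v
        outer ((Uv , _) , f) ¬P = Uv , λ v∈S → ¬P (f v∈S)

      cut : ∃[ q ] q ∈ S × Inner q
      cut with any? (λ q → (q ∈? S) ×-dec inner? q)
      ... | yes found = found
      ... | no none   = contradiction
        (_ , _ , _ , claw-kept , triangle-kept , survives 0 (stop (origin walk-ax)) walk-ax refl) unmixed
        where
        -- If S contains no inner vertex, every walk of length D from a to x is
        -- left; u is the vertex reached after i steps.
        survives : ∀ i {j u} → Walk U i u a → Walk U j u x → i + j ≡ D → Walk W j u x
        survives i       q (stop _)             eq = stop (corner∈ triangle-kept)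
        survives zero    (stop _) (step Ua e r) eq =
          step (centre∈ claw-kept) e (survives 1 (step (origin r) (adj-flip true e) (stop Ua)) r eq)
        survives (suc i) {suc j} q (step Uu e r) eq =
          step (Uu , λ u∈S → none (_ , u∈S , inner i j eq q (step Uu e r))) e
               (survives (suc (suc i)) (step (origin r) (adj-flip true e) q) r
                         (trans (cong suc (sym (+-suc i j))) eq))

      -- A walk in W′ that starts outside the inner vertices stays in W until it
      -- either reaches its end or enters the inner vertices, by way of a.
      reach : ∀ {i u v} → Walk W′ i u v → ¬ Inner u → (∃[ j ] Walk W j u a) ⊎ (¬ Inner v × ∃[ j ] Walk W j u v)
      reach (stop Wu) ¬Pu = inj₂ (¬Pu , 0 , stop (outer Wu ¬Pu))
      reach (step {v = v} Wu e p) ¬Pu with inner? v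
      ... | no ¬Pv with reach p ¬Pv
      ... | inj₁ (j , q)       = inj₁ (suc j , step (outer Wu ¬Pu) e q)
      ... | inj₂ (¬Pw , j , q) = inj₂ (¬Pw , suc j , step (outer Wu ¬Pu) e q)
      reach (step {v = v} Wu e p) ¬Pu | yes Pv with inner-neighbour Pv (proj₁ (proj₁ Wu)) (adj-flip true e)
      ... | inj₁ Pu          = contradiction Pu ¬Pu
      ... | inj₂ (inj₁ refl) = inj₁ (0 , stop (outer Wu ¬Pu))
      ... | inj₂ (inj₂ u≡x)  = contradiction u≡x (proj₂ (proj₁ Wu))

      triangle-outer : ∀ {y} → Triangle W′ y → ¬ Inner y × Triangle W y
      triangle-outer {y} (y₂ , y₃ , (W₁ ∷ W₂ ∷ W₃ ∷ []) , T) =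
        ¬P₁ , y₂ , y₃ , (outer W₁ ¬P₁ ∷ outer W₂ ¬P₂ ∷ outer W₃ ¬P₃ ∷ []) , T
        where
        ¬P₁ : ¬ Inner y
        ¬P₁ P = inner-∉-triangle P (_ , _ , All.map (proj₁ ∘ proj₁) (W₁ ∷ W₂ ∷ W₃ ∷ []) , T)
        ¬P₂ : ¬ Inner y₂
        ¬P₂ P = inner-∉-triangle P
          (_ , _ , All.map (proj₁ ∘ proj₁) (W₂ ∷ W₃ ∷ W₁ ∷ []) , triangle-rotate T)
        ¬P₃ : ¬ Inner y₃
        ¬P₃ P = inner-∉-triangle P
          (_ , _ , All.map (proj₁ ∘ proj₁) (W₃ ∷ W₁ ∷ W₂ ∷ []) , triangle-rotate (triangle-rotate T))

      leaf-outer : ∀ {c ℓ} → W′ c → ¬ Inner c → W′ ℓ → Adj c ℓ → c ≡ a ⊎ W ℓ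
      leaf-outer {c} {ℓ} Wc ¬Pc Wℓ e with inner? ℓ
      ... | no ¬Pℓ = inj₂ (outer Wℓ ¬Pℓ)
      ... | yes Pℓ with inner-neighbour Pℓ (proj₁ (proj₁ Wc)) (adj-flip true e)
      ... | inj₁ Pc         = contradiction Pc ¬Pc
      ... | inj₂ (inj₁ c≡a) = inj₁ c≡a
      ... | inj₂ (inj₂ c≡x) = contradiction c≡x (proj₂ (proj₁ Wc))

      -- A claw of W′ with an inner leaf has centre a, where W has a claw already.
      claw-outer : ∀ {c} → ¬ Inner c → Claw W′ c → Claw W c
      claw-outer ¬Pc (l₁ , l₂ , l₃ , (Wc ∷ W₁ ∷ W₂ ∷ W₃ ∷ []) , J@((e₁ , e₂ , e₃) , _))
        with leaf-outer Wc ¬Pc W₁ e₁ | leaf-outer Wc ¬Pc W₂ e₂ | leaf-outer Wc ¬Pc W₃ e₃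
      ... | inj₁ refl | _         | _         = claw-kept
      ... | inj₂ _    | inj₁ refl | _         = claw-kept
      ... | inj₂ _    | inj₂ _    | inj₁ refl = claw-kept
      ... | inj₂ V₁   | inj₂ V₂   | inj₂ V₃   = l₁ , l₂ , l₃ , (outer Wc ¬Pc ∷ V₁ ∷ V₂ ∷ V₃ ∷ []) , J

      exchange : ¬ Mixed W′
      exchange (_ , c , y , J , T , p) with triangle-outer T
      ... | ¬Py , T′ with reach (reverse p) ¬Py
      ... | inj₁ (j , q)       = unmixed (j , a , y , claw-kept , T′ , reverse q)
      ... | inj₂ (¬Pc , j , q) = unmixed (j , c , y , claw-outer ¬Pc J , T′ , reverse q)

------------------------------------------------------------------------
-- Solutions and branching

  -- At most k vertices can be deleted from U such that the rest is not mixed.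
  Solvable : Subset n → ℕ → Set
  Solvable U k = ∃[ S ] ∣ S ∣ ≤ k × ¬ Mixed (λ v → v ∈ U × v ∉ S)

  solvable-unmixed : ∀ {U k} → ¬ Mixed (_∈ U) → Solvable U k
  solvable-unmixed {U} {k} unmixed = ⊥ , subst (_≤ k) (sym (∣⊥∣≡0 n)) z≤n , unmixed ∘ mixed-map proj₁

  unsolvable-mixed : ∀ {U} → Mixed (_∈ U) → ¬ Solvable U 0
  unsolvable-mixed mixed (S , ∣S∣≤0 , unmixed) =
    unmixed (mixed-map (λ v∈U → v∈U , λ v∈S → n≮0 (≤-trans (x∈p⇒∣p-x∣<∣p∣ v∈S) ∣S∣≤0)) mixed)

  solvable-add : ∀ {U k} v → Solvable (U - v) k → Solvable U (suc k)
  solvable-add {U} {k} v (S , ∣S∣≤k , unmixed) =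
    ⁅ v ⁆ ∪ S , ≤-trans (∣⁅x⁆∪p∣≤1+∣p∣ v S) (s≤s ∣S∣≤k) , unmixed ∘ mixed-map move
    where
    move : ∀ {u} → u ∈ U × u ∉ ⁅ v ⁆ ∪ S → u ∈ U - v × u ∉ S
    move (u∈U , u∉) =
      x∈p∧x≢y⇒x∈p-y u∈U (λ { refl → u∉ (x∈p∪q⁺ (inj₁ (x∈⁅x⁆ v))) }) , λ u∈S → u∉ (x∈p∪q⁺ (inj₂ u∈S))

  solvable-drop : ∀ {U S k v} → ∣ S ∣ ≤ suc k → v ∈ S → ¬ Mixed (λ u → u ∈ U × u ∉ S) → Solvable (U - v) k
  solvable-drop {U} {S} {k} {v} ∣S∣≤ v∈S unmixed =
    S - v , ≤-pred (≤-trans (x∈p⇒∣p-x∣<∣p∣ v∈S) ∣S∣≤) , unmixed ∘ mixed-map move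
    where
    move : ∀ {u} → u ∈ U - v × u ∉ S - v → u ∈ U × u ∉ S
    move (u∈ , u∉) = p─q⊆p U ⁅ v ⁆ u∈ , λ u∈S → u∉ (x∈p∧x≢y⇒x∈p-y u∈S (x∈p-y⇒x≢y U u∈))

  -- A claw with vertices a, b, c, d and centre a and a triangle x, y, z such that
  -- no walk from the centre of a claw to a triangle is shorter than one from a
  -- to x.
  Closest : (U : Subset n) (a b c d x y z : Fin n) → Set
  Closest U a b c d x y z = ∃[ D ]
      (All (_∈ U) (a ∷ b ∷ c ∷ d ∷ []) × IsClaw a b c d)
    × (All (_∈ U) (x ∷ y ∷ z ∷ []) × IsTriangle x y z)
    × Walk (_∈ U) D a x
    × (∀ {i} → Obstructed (_∈ U) i → D ≤ i)

  -- If U can be solved with budget k + 1, then some corner of a closest pair can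
  -- be deleted such that the rest can be solved with budget k.
  branch-complete : ∀ {U k a b c d x y z} → Closest U a b c d x y z → Solvable U (suc k) →
                    Any (λ v → Solvable (U - v) k) (a ∷ b ∷ c ∷ d ∷ x ∷ y ∷ z ∷ [])
  branch-complete {U} {k} {a} {b} {c} {d} {x} {y} {z} (D , (J∈ , J) , (T∈ , T) , p , closest) (S , ∣S∣≤ , unmixed)
    with Any.any? (_∈? S) (a ∷ b ∷ c ∷ d ∷ x ∷ y ∷ z ∷ [])
  ... | yes hit = Any.map (λ v∈S → solvable-drop ∣S∣≤ v∈S unmixed) hit
  -- Delete x, in exchange for the inner vertices.
  ... | no miss = there (there (there (there (here
      ( S ─ comprehension inner? , ≤-pred (≤-trans smaller ∣S∣≤)
      , λ m → exchange S J′ T′ unmixed (mixed-map move m))))))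
    where
    open Exchange (_∈? U) (b , c , d , J∈ , J) (y , z , T∈ , T) p closest
    kept : All (_∉ S) (a ∷ b ∷ c ∷ d ∷ x ∷ y ∷ z ∷ [])
    kept = Allₚ.¬Any⇒All¬ _ miss
    J′ : Claw (λ v → v ∈ U × v ∉ S) a
    J′ = b , c , d , All.zip (J∈ , Allₚ.++⁻ˡ (a ∷ b ∷ c ∷ d ∷ []) kept) , J
    T′ : Triangle (λ v → v ∈ U × v ∉ S) x
    T′ = y , z , All.zip (T∈ , Allₚ.++⁻ʳ (a ∷ b ∷ c ∷ d ∷ []) kept) , T
    smaller : ∣ S ─ comprehension inner? ∣ < ∣ S ∣
    smaller with cut S J′ T′ unmixed
    ... | q , q∈S , Pq = p∩q≢∅⇒∣p─q∣<∣p∣ S _ (q , x∈p∩q⁺ (q∈S , ∈-comprehension⁺ inner? Pq))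
    move : ∀ {v} → v ∈ U - x × v ∉ S ─ comprehension inner? → (v ∈ U × v ≢ x) × (v ∈ S → Inner v)
    move {v} (v∈ , v∉) = (p─q⊆p U ⁅ x ⁆ v∈ , x∈p-y⇒x≢y U v∈) , λ v∈S → in-inner v∈S
      where
      in-inner : v ∈ S → Inner v
      in-inner v∈S with inner? v
      ... | yes Pv = Pv
      ... | no ¬Pv = contradiction (x∈p∧x∉q⇒x∈p─q v∈S (¬Pv ∘ ∈-comprehension⁻ inner?)) v∉

------------------------------------------------------------------------
-- Connected components

  walk⇒connected : ∀ {U : Subset n} {i u v} → Walk (_∈ U) i u v → ConnectedIn G U u v
  walk⇒connected (stop _)      = ε
  walk⇒connected (step u∈ e p) = (u∈ , origin p , e) ◅ walk⇒connected p

  connected⇒walk : ∀ {U : Subset n} {u v} → u ∈ U → ConnectedIn G U u v → ∃[ i ] Walk (_∈ U) i u v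
  connected⇒walk u∈ ε                    = 0 , stop u∈
  connected⇒walk _  ((u∈ , v∈ , e) ◅ p) with connected⇒walk v∈ p
  ... | i , q = suc i , step u∈ e q

  joined? : ∀ (U : Subset n) u v → Dec (∃[ i ] Walk (_∈ U) i u v)
  joined? U u v = map′ (λ { (i , _ , p) → i , p }) (λ { (_ , p) → shorten n (∣p∣≤n U) p })
    (anyUpTo? (λ i → walk? (_∈? U) i u v) n)

  induced⇒claw : ∀ {C} → HasInduced G C claw → ∃[ a ] Claw (_∈ C) a
  induced⇒claw (f , inj , f∈ , f-adj) = f 0F , f 1F , f 2F , f 3F ,
    (f∈ _ ∷ f∈ _ ∷ f∈ _ ∷ f∈ _ ∷ []) ,
    (f-adj _ _ , f-adj _ _ , f-adj _ _) , (f-adj _ _ , f-adj _ _ , f-adj _ _) ,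
    ((λ e → contradiction (inj e) λ ()) , (λ e → contradiction (inj e) λ ()) , (λ e → contradiction (inj e) λ ()))

  induced⇒triangle : ∀ {C} → HasInduced G C triangle → ∃[ x ] Triangle (_∈ C) x
  induced⇒triangle (f , inj , f∈ , f-adj) = f 0F , f 1F , f 2F ,
    (f∈ _ ∷ f∈ _ ∷ f∈ _ ∷ []) , (f-adj _ _ , f-adj _ _ , f-adj _ _)

  claw⇒induced : ∀ {C a} → Claw (_∈ C) a → HasInduced G C claw
  claw⇒induced {C} {a} (b , c , d , (a∈ ∷ b∈ ∷ c∈ ∷ d∈ ∷ []) , (ab , ac , ad) , (bc , bd , cd) , (b≢c , b≢d , c≢d)) =
    f , inj , f∈ , f-adj
    where
    f : Fin 4 → Fin n
    f = lookup (a ∷ b ∷ c ∷ d ∷ [])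
    f∈ : ∀ i → f i ∈ C
    f∈ 0F = a∈
    f∈ 1F = b∈
    f∈ 2F = c∈
    f∈ 3F = d∈
    inj : Injective _≡_ _≡_ f
    inj {0F} {0F} _ = refl
    inj {0F} {1F} e = contradiction e (adj-≢ ab)
    inj {0F} {2F} e = contradiction e (adj-≢ ac)
    inj {0F} {3F} e = contradiction e (adj-≢ ad)
    inj {1F} {0F} e = contradiction (sym e) (adj-≢ ab)
    inj {1F} {1F} _ = refl
    inj {1F} {2F} e = contradiction e b≢c
    inj {1F} {3F} e = contradiction e b≢d
    inj {2F} {0F} e = contradiction (sym e) (adj-≢ ac)
    inj {2F} {1F} e = contradiction (sym e) b≢c
    inj {2F} {2F} _ = refl
    inj {2F} {3F} e = contradiction e c≢d
    inj {3F} {0F} e = contradiction (sym e) (adj-≢ ad)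
    inj {3F} {1F} e = contradiction (sym e) b≢d
    inj {3F} {2F} e = contradiction (sym e) c≢d
    inj {3F} {3F} _ = refl
    f-adj : ∀ i j → adj G (f i) (f j) ≡ adj claw i j
    f-adj 0F 0F = adj-irrefl G a
    f-adj 0F 1F = ab
    f-adj 0F 2F = ac
    f-adj 0F 3F = ad
    f-adj 1F 0F = adj-flip true ab
    f-adj 1F 1F = adj-irrefl G b
    f-adj 1F 2F = bc
    f-adj 1F 3F = bd
    f-adj 2F 0F = adj-flip true ac
    f-adj 2F 1F = adj-flip false bc
    f-adj 2F 2F = adj-irrefl G c
    f-adj 2F 3F = cd
    f-adj 3F 0F = adj-flip true ad
    f-adj 3F 1F = adj-flip false bd
    f-adj 3F 2F = adj-flip false cd
    f-adj 3F 3F = adj-irrefl G d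

  triangle⇒induced : ∀ {C x} → Triangle (_∈ C) x → HasInduced G C triangle
  triangle⇒induced {C} {x} (y , z , (x∈ ∷ y∈ ∷ z∈ ∷ []) , (xy , xz , yz)) = f , inj , f∈ , f-adj
    where
    f : Fin 3 → Fin n
    f = lookup (x ∷ y ∷ z ∷ [])
    f∈ : ∀ i → f i ∈ C
    f∈ 0F = x∈
    f∈ 1F = y∈
    f∈ 2F = z∈
    inj : Injective _≡_ _≡_ f
    inj {0F} {0F} _ = refl
    inj {0F} {1F} e = contradiction e (adj-≢ xy)
    inj {0F} {2F} e = contradiction e (adj-≢ xz)
    inj {1F} {0F} e = contradiction (sym e) (adj-≢ xy)
    inj {1F} {1F} _ = refl
    inj {1F} {2F} e = contradiction e (adj-≢ yz)
    inj {2F} {0F} e = contradiction (sym e) (adj-≢ xz)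
    inj {2F} {1F} e = contradiction (sym e) (adj-≢ yz)
    inj {2F} {2F} _ = refl
    f-adj : ∀ i j → adj G (f i) (f j) ≡ adj triangle i j
    f-adj 0F 0F = adj-irrefl G x
    f-adj 0F 1F = xy
    f-adj 0F 2F = xz
    f-adj 1F 0F = adj-flip true xy
    f-adj 1F 1F = adj-irrefl G y
    f-adj 1F 2F = yz
    f-adj 2F 0F = adj-flip true xz
    f-adj 2F 1F = adj-flip true yz
    f-adj 2F 2F = adj-irrefl G z

  unmixed⇒solution : ∀ {S} → ¬ Mixed (_∈ ∁ S) → IsSolution G S
  unmixed⇒solution {S} unmixed C (u , u∈ , C⇔) with any? (claw? (_∈? C))
  ... | no clawless      = inj₁ (clawless ∘ induced⇒claw)
  ... | yes (a , claw-a) = inj₂ mixes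
    where
    from-u : ∀ {v} → v ∈ C → ∃[ i ] Walk (_∈ ∁ S) i u v
    from-u v∈C = connected⇒walk u∈ (proj₂ (Equivalence.to (C⇔ _) v∈C))
    kept : ∀ {v} → v ∈ C → v ∈ ∁ S
    kept v∈C = proj₁ (Equivalence.to (C⇔ _) v∈C)
    mixes : TriangleFree G C
    mixes h with induced⇒triangle h
    ... | x , triangle-x with from-u (centre∈ claw-a) | from-u (corner∈ triangle-x)
    ... | i , p | j , q = unmixed (_ , a , x , claw-map kept claw-a , triangle-map kept triangle-x , (reverse p ⁀ q))

  solution⇒unmixed : ∀ {S} → IsSolution G S → ¬ Mixed (_∈ ∁ S)
  solution⇒unmixed {S} solution (i , a , x , (b , c , d , (a∈ ∷ b∈ ∷ c∈ ∷ d∈ ∷ []) , J@((ab , ac , ad) , _)) ,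
                                 (y , z , (x∈ ∷ y∈ ∷ z∈ ∷ []) , T@(xy , xz , _)) , p) =
    case solution C component of λ
      { (inj₁ clawfree) → clawfree (claw⇒induced
          (b , c , d , (reached (stop a∈) ∷ beside ab b∈ ∷ beside ac c∈ ∷ beside ad d∈ ∷ []) , J))
      ; (inj₂ trianglefree) → trianglefree (triangle⇒induced
          (y , z , (reached p ∷ reached (p ⁀ step x∈ xy (stop y∈)) ∷ reached (p ⁀ step x∈ xz (stop z∈)) ∷ []) , T))
      }
    where
    -- The component of a.
    C : Subset n
    C = comprehension (joined? (∁ S) a)
    reached : ∀ {j v} → Walk (_∈ ∁ S) j a v → v ∈ C
    reached q = ∈-comprehension⁺ (joined? (∁ S) a) (_ , q)
    beside : ∀ {v} → Adj a v → v ∈ ∁ S → v ∈ C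
    beside e v∈ = reached (step a∈ e (stop v∈))
    component : IsComponent G (∁ S) C
    component = a , a∈ , λ v → mk⇔
      (λ v∈C → let j , q = ∈-comprehension⁻ (joined? (∁ S) a) v∈C in origin (reverse q) , walk⇒connected q)
      (λ { (_ , a~v) → ∈-comprehension⁺ (joined? (∁ S) a) (connected⇒walk a∈ a~v) })

  hasSolution⇒solvable : ∀ {U k} → HasSolutionOfSize≤ G k → Solvable U k
  hasSolution⇒solvable (S , ∣S∣≤k , solution) =
    S , ∣S∣≤k , solution⇒unmixed solution ∘ mixed-map (x∉p⇒x∈∁p ∘ proj₂)

  solvable⇒hasSolution : ∀ {U k} → (∀ v → v ∈ U) → Solvable U k → HasSolutionOfSize≤ G k
  solvable⇒hasSolution full (S , ∣S∣≤k , unmixed) =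
    S , ∣S∣≤k , unmixed⇒solution (unmixed ∘ mixed-map λ v∈∁S → full _ , x∈∁p⇒x∉p v∈∁S)

------------------------------------------------------------------------
-- Correctness of the search tree

any-reflects : ∀ {A : Set} {P : A → Set} {p : A → Bool} → (∀ u → Reflects (P u) (p u)) →
               ∀ us → Reflects (Any P us) (any p us)
any-reflects r [] = ofⁿ λ ()
any-reflects {p = p} r (u ∷ us) with p u | r u | any p us | any-reflects r us
... | true  | ofʸ Pu | _     | _       = ofʸ (here Pu)
... | false | ofⁿ _  | true  | ofʸ Pus = ofʸ (there Pus)
... | false | ofⁿ ¬u | false | ofⁿ ¬us = ofⁿ λ { (here Pu) → ¬u Pu ; (there Pus) → ¬us Pus }

map-reflects : ∀ {P Q : Set} {b} → (P → Q) → (Q → P) → Reflects P b → Reflects Q b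
map-reflects f g (ofʸ p)  = ofʸ (f p)
map-reflects f g (ofⁿ ¬p) = ofⁿ (¬p ∘ g)

module _ {n : ℕ} (G : Graph n) where

  open GraphTheory G

  -- Correct lists of branches for the state U.
  data Branching (U : Subset n) : List (Subset n) → Set where
    finished : ¬ Mixed (_∈ U) → Branching U []
    split    : ∀ {a b c d x y z} → Closest U a b c d x y z →
               Branching U (List.map (U -_) (a ∷ b ∷ c ∷ d ∷ x ∷ y ∷ z ∷ []))

  module _ {f : Subset n → List (Subset n)} (branching : ∀ U → Branching U (f U)) where

    mutual

      search-reflects : ∀ k U → Reflects (Solvable U k) (search f k U)
      search-reflects k U = continue-reflects k (branching U)

      continue-reflects : ∀ k {U us} → Branching U us → Reflects (Solvable U k) (continue f k us)
      continue-reflects k       (finished unmixed) = ofʸ (solvable-unmixed unmixed)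
      continue-reflects zero    (split (D , J , T , p , _)) =
        ofⁿ (unsolvable-mixed (D , _ , _ , (_ , _ , _ , J) , (_ , _ , T) , p))
      continue-reflects (suc k) {U} (split {a} {b} {c} {d} {x} {y} {z} closest) = map-reflects
        (λ hit → let v , sol = Any.satisfied (map⁻ {f = U -_} {xs = a ∷ b ∷ c ∷ d ∷ x ∷ y ∷ z ∷ []} hit)
                 in  solvable-add v sol)
        (λ sol → map⁺ {f = U -_} (branch-complete closest sol))
        (any-reflects (search-reflects k) (List.map (U -_) (a ∷ b ∷ c ∷ d ∷ x ∷ y ∷ z ∷ [])))

------------------------------------------------------------------------
-- The branching step as a term

Matrix : Ty
Matrix = vec (vec bool)

module _ {Γ : Ctx} where

  entry : Γ ⊢ Matrix → fin ∈ˡ Γ → fin ∈ˡ Γ → Γ ⊢ bool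
  entry M u v = at (at M (var u)) (var v)

  notₜ : Γ ⊢ bool → Γ ⊢ bool
  notₜ e = cond e (lit false) (lit true)

  allₜ : List (Γ ⊢ bool) → Γ ⊢ bool
  allₜ = List.foldr (λ d e → cond d e (lit false)) (lit true)

  -- The first nonempty list among those for the indices 0, 1, and so on.
  firstₜ : ∀ {σ τ} → vec σ ∈ˡ Γ → fin ∷ list τ ∷ Γ ⊢ list τ → Γ ⊢ list τ
  firstₜ M e = fold M nil (orElse e (var v1))

  -- The set U without v.
  removeₜ : vec bool ∈ˡ Γ → fin ∈ˡ Γ → Γ ⊢ vec bool
  removeₜ U v = tab U (cond (same (var v0) (var (there v))) (lit false) (at (var (there U)) (var v0)))

-- The state of the main loop consists of the matrix of the walks of the current
-- length and the branches found so far.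
State : Ty
State = Matrix ⊗ list (vec bool)

-- The branches for the corners a, b, c, d, x, y, z, provided that these form a
-- claw and a triangle in U and that the current matrix has a walk from a to x.
-- Each loop puts its index and the result of the later iterations into the
-- context, so the corners are at the even positions, z first; the index and the
-- state of the main loop are at 14 and 15.
cornersₜ : fin ∷ list (vec bool) ∷ fin ∷ list (vec bool) ∷ fin ∷ list (vec bool) ∷ fin ∷ list (vec bool) ∷
           fin ∷ list (vec bool) ∷ fin ∷ list (vec bool) ∷ fin ∷ list (vec bool) ∷
           fin ∷ State ∷ Matrix ∷ vec bool ∷ [] ⊢ list (vec bool)
cornersₜ = cond
  (allₜ ( at U (var a) ∷ at U (var b) ∷ at U (var c) ∷ at U (var d)
        ∷ entry M a b ∷ entry M a c ∷ entry M a d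
        ∷ notₜ (entry M b c) ∷ notₜ (entry M b d) ∷ notₜ (entry M c d)
        ∷ notₜ (same (var b) (var c)) ∷ notₜ (same (var b) (var d)) ∷ notₜ (same (var c) (var d))
        ∷ at U (var x) ∷ at U (var y) ∷ at U (var z)
        ∷ entry M x y ∷ entry M x z ∷ entry M y z
        ∷ entry (fst (var v15)) a x ∷ []))
  (cons (removeₜ v17 a) (cons (removeₜ v17 b) (cons (removeₜ v17 c) (cons (removeₜ v17 d)
  (cons (removeₜ v17 x) (cons (removeₜ v17 y) (cons (removeₜ v17 z) nil)))))))
  nil
  where
  pattern a = v12
  pattern b = v10
  pattern c = v8
  pattern d = v6
  pattern x = v4
  pattern y = v2
  pattern z = v0
  M = var v16
  U = var v17

findₜ : fin ∷ State ∷ Matrix ∷ vec bool ∷ [] ⊢ list (vec bool)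
findₜ = firstₜ v2 (firstₜ v4 (firstₜ v6 (firstₜ v8 (firstₜ v10 (firstₜ v12 (firstₜ v14 cornersₜ))))))

-- The walks that are longer by one step.  The variables of the inner test are,
-- in order, w, the result for the later w, v, u, the loop index, the state, the
-- adjacency matrix and U.
extendₜ : fin ∷ State ∷ Matrix ∷ vec bool ∷ [] ⊢ Matrix
extendₜ = tab v2 (tab v3 (fold v4 (lit false)
  (cond (allₜ (at (var v7) (var v3) ∷ entry (var v6) v3 v0 ∷ entry (fst (var v5)) v0 v2 ∷ []))
        (lit true) (var v1))))

-- The walks of length 0.
startₜ : Matrix ∷ vec bool ∷ [] ⊢ Matrix
startₜ = tab v0 (tab v1 (cond (same (var v1) (var v0)) (at (var v3) (var v1)) (lit false)))

-- Searches for a closest pair with walks of the lengths 0, ..., n - 1.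
branchₜ : Matrix ∷ vec bool ∷ [] ⊢ list (vec bool)
branchₜ = snd (fold v0 (pair startₜ nil)
                       (pair extendₜ (orElse (snd (var v1)) findₜ)))

rootₜ : Matrix ∷ [] ⊢ vec bool
rootₜ = tab v0 (lit true)

------------------------------------------------------------------------
-- Correctness of the branching step

-- The meaning of `removeₜ`.
remove : ∀ {n} → Subset n → Fin n → Subset n
remove U v = tabulate λ i → if does (i ≟ v) then false else lookup U i

remove≡- : ∀ {n} (U : Subset n) v → remove U v ≡ U - v
remove≡- U v = trans (Vecₚ.tabulate-cong (pointwise U v)) (tabulate∘lookup (U - v))
  where
  pointwise : ∀ {n} (U : Subset n) v i → (if does (i ≟ v) then false else lookup U i) ≡ lookup (U - v) i
  pointwise (_ ∷ U) zero    zero    = refl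
  pointwise (_ ∷ U) (suc v) zero    = refl
  pointwise (_ ∷ U) zero    (suc i) = cong (λ V → lookup V i) (sym (p─⊥≡p U))
  pointwise (_ ∷ U) (suc v) (suc i) = pointwise U v i

-- The meaning of `firstₜ`.
first : ∀ {n} {A : Set} → (Fin n → List A) → List A
first f = foldr (λ i ys → f i <∣> ys) [] id

<∣>-[] : ∀ {A : Set} (xs : List A) {ys} → xs <∣> ys ≡ [] → xs ≡ [] × ys ≡ []
<∣>-[] [] e = refl , e

<∣>-∷ : ∀ {A : Set} (xs : List A) {ys z zs} → xs <∣> ys ≡ z ∷ zs → xs ≡ z ∷ zs ⊎ ys ≡ z ∷ zs
<∣>-∷ []      e = inj₂ e
<∣>-∷ (_ ∷ _) e = inj₁ e

module _ {A : Set} where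

  private

    firstOf : ∀ {m n} → (Fin n → List A) → (Fin m → Fin n) → List A
    firstOf f g = foldr (λ i ys → f i <∣> ys) [] g

    firstOf-[] : ∀ {m n} (f : Fin n → List A) (g : Fin m → Fin n) → firstOf f g ≡ [] → ∀ i → f (g i) ≡ []
    firstOf-[] f g e zero    = proj₁ (<∣>-[] (f (g zero)) e)
    firstOf-[] f g e (suc i) = firstOf-[] f (g ∘ suc) (proj₂ (<∣>-[] (f (g zero)) e)) i

    firstOf-∷ : ∀ {m n} (f : Fin n → List A) (g : Fin m → Fin n) {z zs} →
                firstOf f g ≡ z ∷ zs → ∃[ i ] f i ≡ z ∷ zs
    firstOf-∷ {suc m} f g e with <∣>-∷ (f (g zero)) e
    ... | inj₁ e₁ = g zero , e₁
    ... | inj₂ e₂ = firstOf-∷ f (g ∘ suc) e₂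

  first-[] : ∀ {n} {f : Fin n → List A} → first f ≡ [] → ∀ i → f i ≡ []
  first-[] = firstOf-[] _ id

  first-∷ : ∀ {n} {f : Fin n → List A} {z zs} → first f ≡ z ∷ zs → ∃[ i ] f i ≡ z ∷ zs
  first-∷ = firstOf-∷ _ id

-- The meanings of `allₜ` and `notₜ`.
allOf : List Bool → Bool
allOf = List.foldr (λ b r → if b then r else false) true

neg : Bool → Bool
neg b = if b then false else true

allOf⁻ : ∀ bs → allOf bs ≡ true → All (_≡ true) bs
allOf⁻ []           _ = []
allOf⁻ (true ∷ bs)  e = refl ∷ allOf⁻ bs e

allOf⁺ : ∀ {bs} → All (_≡ true) bs → allOf bs ≡ true
allOf⁺ []         = refl
allOf⁺ (refl ∷ p) = allOf⁺ p

neg⁻ : ∀ {b} → neg b ≡ true → b ≡ false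
neg⁻ {false} _ = refl

neg⁺ : ∀ {b} → b ≡ false → neg b ≡ true
neg⁺ refl = refl

-- What the parts of the branching term compute, for an adjacency matrix M, a
-- vertex set U and a matrix R of walks.
module Meaning {n : ℕ} (M : Vec (Subset n) n) (U : Subset n) where

  bit : Vec (Subset n) n → Fin n → Fin n → Bool
  bit M u v = lookup (lookup M u) v

  eq : Fin n → Fin n → Bool
  eq u v = does (u ≟ v)

  tests : (R : Vec (Subset n) n) (a b c d x y z : Fin n) → List Bool
  tests R a b c d x y z =
      lookup U a ∷ lookup U b ∷ lookup U c ∷ lookup U d
    ∷ bit M a b ∷ bit M a c ∷ bit M a d
    ∷ neg (bit M b c) ∷ neg (bit M b d) ∷ neg (bit M c d)
    ∷ neg (eq b c) ∷ neg (eq b d) ∷ neg (eq c d)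
    ∷ lookup U x ∷ lookup U y ∷ lookup U z
    ∷ bit M x y ∷ bit M x z ∷ bit M y z
    ∷ bit R a x ∷ []

  corners : (R : Vec (Subset n) n) (a b c d x y z : Fin n) → List (Subset n)
  corners R a b c d x y z =
    if allOf (tests R a b c d x y z) then List.map (remove U) (a ∷ b ∷ c ∷ d ∷ x ∷ y ∷ z ∷ []) else []

  find : Vec (Subset n) n → List (Subset n)
  find R = first λ a → first λ b → first λ c → first λ d → first λ x → first λ y → first λ z →
    corners R a b c d x y z

  extend : Vec (Subset n) n → Vec (Subset n) n
  extend R = tabulate λ u → tabulate λ v →
    foldr (λ w y → if allOf (lookup U u ∷ bit M u w ∷ bit R w v ∷ []) then true else y) false id

  start : Vec (Subset n) n
  start = tabulate λ u → tabulate λ v → if eq u v then lookup U u else false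

  next : Vec (Subset n) n × List (Subset n) → Vec (Subset n) n × List (Subset n)
  next (R , res) = extend R , res <∣> find R

below-suc : ∀ {P : ℕ → Set} {i} → (∀ {j} → j < i → ¬ P j) → ¬ P i → ∀ {j} → j < suc i → ¬ P j
below-suc below at-i j<1+i with m<1+n⇒m<n∨m≡n j<1+i
... | inj₁ j<i  = below j<i
... | inj₂ refl = at-i

module _ {n : ℕ} where

  different⁻ : ∀ {u v : Fin n} → does (u ≟ v) ≡ false → u ≢ v
  different⁻ {u} {v} e with u ≟ v
  ... | no ¬p = ¬p

  lookup-matrix : (f : Fin n → Fin n → Bool) → ∀ u v →
                  lookup (lookup (tabulate λ u → tabulate (f u)) u) v ≡ f u v
  lookup-matrix f u v = trans (cong (λ r → lookup r v) (lookup∘tabulate _ u)) (lookup∘tabulate (f u) v)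

  foldr-exists⁻ : ∀ {m} (f : Fin n → Bool) (g : Fin m → Fin n) →
                  foldr (λ i y → if f i then true else y) false g ≡ true → ∃[ i ] f i ≡ true
  foldr-exists⁻ {suc m} f g e with f (g zero) in eq
  ... | true  = g zero , eq
  ... | false = foldr-exists⁻ f (g ∘ suc) e

  foldr-exists⁺ : ∀ {m} (f : Fin n → Bool) (g : Fin m → Fin n) i → f (g i) ≡ true →
                  foldr (λ i y → if f i then true else y) false g ≡ true
  foldr-exists⁺ f g zero e rewrite e = refl
  foldr-exists⁺ f g (suc i) e with f (g zero)
  ... | true  = refl
  ... | false = foldr-exists⁺ f (g ∘ suc) i e

matrix : ∀ {n} → Graph n → Vec (Subset n) n
matrix G = tabulate λ u → tabulate (adj G u)

module Correctness {n : ℕ} (G : Graph n) (U : Subset n) where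

  open GraphTheory G

  private
    M : Vec (Subset n) n
    M = matrix G

  open Meaning M U

  edge : ∀ u v → bit M u v ≡ adj G u v
  edge = lookup-matrix (adj G)

  -- R is the matrix of the walks of length i in U.
  record IsWalks (i : ℕ) (R : Vec (Subset n) n) : Set where
    constructor isWalks
    field
      walk⁻ : ∀ u v → bit R u v ≡ true → Walk (_∈ U) i u v
      walk⁺ : ∀ u v → Walk (_∈ U) i u v → bit R u v ≡ true

  open IsWalks

  start-walks : IsWalks 0 start
  start-walks = isWalks
    (λ u v e → to u v (trans (sym (entry-start u v)) e))
    (λ u v p → trans (entry-start u v) (from u v p))
    where
    diagonal : Fin n → Fin n → Bool
    diagonal u v = if eq u v then lookup U u else false
    entry-start : ∀ u v → bit start u v ≡ diagonal u v
    entry-start = lookup-matrix diagonal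
    to : ∀ u v → diagonal u v ≡ true → Walk (_∈ U) 0 u v
    to u v e with u ≟ v
    ... | yes refl = stop (lookup⇒[]= u U e)
    from : ∀ u v → Walk (_∈ U) 0 u v → diagonal u v ≡ true
    from u v (stop u∈) rewrite dec-true (u ≟ u) refl = []=⇒lookup u∈

  extend-walks : ∀ {i R} → IsWalks i R → IsWalks (suc i) (extend R)
  extend-walks {i} {R} R-walks = isWalks
    (λ u v e → to u v (trans (sym (entry-extend u v)) e))
    (λ u v p → trans (entry-extend u v) (from u v p))
    where
    test : Fin n → Fin n → Fin n → Bool
    test u v w = allOf (lookup U u ∷ bit M u w ∷ bit R w v ∷ [])
    exists : Fin n → Fin n → Bool
    exists u v = foldr (λ w y → if test u v w then true else y) false id
    entry-extend : ∀ u v → bit (extend R) u v ≡ exists u v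
    entry-extend = lookup-matrix exists
    to : ∀ u v → exists u v ≡ true → Walk (_∈ U) (suc i) u v
    to u v e with foldr-exists⁻ (test u v) id e
    ... | w , e′ with allOf⁻ (lookup U u ∷ bit M u w ∷ bit R w v ∷ []) e′
    ... | e₁ ∷ e₂ ∷ e₃ ∷ [] = step (lookup⇒[]= u U e₁) (trans (sym (edge u w)) e₂) (walk⁻ R-walks w v e₃)
    from : ∀ u v → Walk (_∈ U) (suc i) u v → exists u v ≡ true
    from u v (step {v = w} u∈ uw p) = foldr-exists⁺ (test u v) id w
      (allOf⁺ {lookup U u ∷ bit M u w ∷ bit R w v ∷ []}
              ([]=⇒lookup u∈ ∷ trans (edge u w) uw ∷ walk⁺ R-walks w v p ∷ []))

  -- A claw centred at a and a triangle containing x, with a walk of length i.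
  Corners : ℕ → (a b c d x y z : Fin n) → Set
  Corners i a b c d x y z =
      (All (_∈ U) (a ∷ b ∷ c ∷ d ∷ []) × IsClaw a b c d)
    × (All (_∈ U) (x ∷ y ∷ z ∷ []) × IsTriangle x y z)
    × Walk (_∈ U) i a x

  module _ {i R} (R-walks : IsWalks i R) where

    tests⁻ : ∀ a b c d x y z → allOf (tests R a b c d x y z) ≡ true → Corners i a b c d x y z
    tests⁻ a b c d x y z e with allOf⁻ (tests R a b c d x y z) e
    ... | a∈ ∷ b∈ ∷ c∈ ∷ d∈ ∷ ab ∷ ac ∷ ad ∷ bc ∷ bd ∷ cd ∷ b≢c ∷ b≢d ∷ c≢d
        ∷ x∈ ∷ y∈ ∷ z∈ ∷ xy ∷ xz ∷ yz ∷ ax ∷ [] =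
      ( (member a∈ ∷ member b∈ ∷ member c∈ ∷ member d∈ ∷ [])
      , (present ab , present ac , present ad) , (absent bc , absent bd , absent cd)
      , (distinct b≢c , distinct b≢d , distinct c≢d))
      , ((member x∈ ∷ member y∈ ∷ member z∈ ∷ []) , present xy , present xz , present yz)
      , walk⁻ R-walks a x ax
      where
      member : ∀ {v} → lookup U v ≡ true → v ∈ U
      member {v} = lookup⇒[]= v U
      present : ∀ {u v} → bit M u v ≡ true → Adj u v
      present = trans (sym (edge _ _))
      absent : ∀ {u v} → neg (bit M u v) ≡ true → adj G u v ≡ false
      absent e = trans (sym (edge _ _)) (neg⁻ e)
      distinct : ∀ {u v} → neg (eq u v) ≡ true → u ≢ v
      distinct e = different⁻ (neg⁻ e)

    tests⁺ : ∀ a b c d x y z → Corners i a b c d x y z → allOf (tests R a b c d x y z) ≡ true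
    tests⁺ a b c d x y z
      ( ((a∈ ∷ b∈ ∷ c∈ ∷ d∈ ∷ []) , (ab , ac , ad) , (bc , bd , cd) , (b≢c , b≢d , c≢d))
      , ((x∈ ∷ y∈ ∷ z∈ ∷ []) , xy , xz , yz) , p) =
      allOf⁺ {tests R a b c d x y z}
             ( []=⇒lookup a∈ ∷ []=⇒lookup b∈ ∷ []=⇒lookup c∈ ∷ []=⇒lookup d∈
             ∷ present ab ∷ present ac ∷ present ad
             ∷ neg⁺ (present bc) ∷ neg⁺ (present bd) ∷ neg⁺ (present cd)
             ∷ distinct b≢c ∷ distinct b≢d ∷ distinct c≢d
             ∷ []=⇒lookup x∈ ∷ []=⇒lookup y∈ ∷ []=⇒lookup z∈
             ∷ present xy ∷ present xz ∷ present yz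
             ∷ walk⁺ R-walks a x p ∷ [])
      where
      present : ∀ {u v b} → adj G u v ≡ b → bit M u v ≡ b
      present = trans (edge _ _)
      distinct : ∀ {u v} → u ≢ v → neg (eq u v) ≡ true
      distinct {u} {v} u≢v = neg⁺ (dec-false (u ≟ v) u≢v)

    find-[] : find R ≡ [] → ¬ Obstructed (_∈ U) i
    find-[] e (a , x , (b , c , d , J) , (y , z , T) , p)
      with first-[] (first-[] (first-[] (first-[] (first-[] (first-[] (first-[] e a) b) c) d) x) y) z
    ... | none rewrite tests⁺ a b c d x y z (J , T , p) = contradiction none λ ()

    find-∷ : ∀ {V Vs} → find R ≡ V ∷ Vs →
             ∃[ a ] ∃[ b ] ∃[ c ] ∃[ d ] ∃[ x ] ∃[ y ] ∃[ z ] Corners i a b c d x y z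
             × V ∷ Vs ≡ List.map (remove U) (a ∷ b ∷ c ∷ d ∷ x ∷ y ∷ z ∷ [])
    find-∷ e with first-∷ e
    ... | a , e with first-∷ e
    ... | b , e with first-∷ e
    ... | c , e with first-∷ e
    ... | d , e with first-∷ e
    ... | x , e with first-∷ e
    ... | y , e with first-∷ e
    ... | z , e with allOf (tests R a b c d x y z) in e′
    ... | true = a , b , c , d , x , y , z , tests⁻ a b c d x y z e′ , sym e
    ... | false = contradiction e λ ()

  -- All lengths below i have been searched, either in vain or with a closest
  -- pair as the result.
  Result : ℕ → List (Subset n) → Set
  Result i Vs = (Vs ≡ [] × (∀ {j} → j < i → ¬ Obstructed (_∈ U) j))
    ⊎ (∃[ a ] ∃[ b ] ∃[ c ] ∃[ d ] ∃[ x ] ∃[ y ] ∃[ z ] Closest U a b c d x y z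
        × Vs ≡ List.map (remove U) (a ∷ b ∷ c ∷ d ∷ x ∷ y ∷ z ∷ []))

  -- The invariant of the main loop after i iterations.
  Searched : ℕ → Vec (Subset n) n × List (Subset n) → Set
  Searched i (R , Vs) = IsWalks i R × Result i Vs

  find-result : ∀ {i R} → IsWalks i R → (∀ {j} → j < i → ¬ Obstructed (_∈ U) j) →
                ∀ Vs → find R ≡ Vs → Result (suc i) Vs
  find-result R-walks none [] e = inj₁ (refl , below-suc {P = Obstructed (_∈ U)} none (find-[] R-walks e))
  find-result {i} R-walks none (V ∷ Vs) e =
    let a , b , c , d , x , y , z , (J , T , p) , eq = find-∷ R-walks e
    in  inj₂ (a , b , c , d , x , y , z , (i , J , T , p , λ o → ≮⇒≥ λ j<i → none j<i o) , eq)

  next-searched : ∀ {i} s → Searched i s → Searched (suc i) (next s)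
  next-searched (R , _) (R-walks , inj₂ (a , b , c , d , x , y , z , found , refl)) =
    extend-walks R-walks , inj₂ (a , b , c , d , x , y , z , found , refl)
  next-searched (R , _) (R-walks , inj₁ (refl , none)) =
    extend-walks R-walks , find-result R-walks none (find R) refl

  iterate-searched : ∀ {m} (g : Fin m → Fin n) → Searched m (foldr (λ _ → next) (start , []) g)
  iterate-searched {zero}  g = start-walks , inj₁ (refl , λ ())
  iterate-searched {suc m} g = next-searched _ (iterate-searched (g ∘ suc))

  -- The denotation of the branching term is, by definition, the second component
  -- of the n-fold iteration of `next` from `start`.
  branching : Branching G U (⟦ branchₜ ⟧ (M ∷ U ∷ []))
  branching with iterate-searched {n} id
  ... | _ , inj₁ (e , none) = subst (Branching G U) (sym e) (finished unmixed)
    where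
    unmixed : ¬ Mixed (_∈ U)
    unmixed (_ , a , x , J , T , p) with shorten n (∣p∣≤n U) p
    ... | _ , j<n , q = none j<n (a , x , J , T , q)
  ... | _ , inj₂ (a , b , c , d , x , y , z , closest , e) =
    subst (Branching G U) (sym (trans e (map-cong (remove≡- U) _))) (split closest)

map-toList-tabulate : ∀ {A B : Set} (f : A → B) {n} (g : Fin n → A) →
                      List.map f (toList (tabulate g)) ≡ List.tabulate (f ∘ g)
map-toList-tabulate f {zero}  g = refl
map-toList-tabulate f {suc n} g = cong (f (g zero) ∷_) (map-toList-tabulate f (g ∘ suc))

enc-matrix : ∀ {n} (G : Graph n) → enc Matrix (matrix G) ≡ encodeGraph G
enc-matrix G = cong encodeList (trans (map-toList-tabulate _ _)
  (tabulate-cong λ u → cong encodeList (map-toList-tabulate encodeBool (adj G u))))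

branching-≤7 : ∀ {n} {G : Graph n} {U Vs} → Branching G U Vs → length Vs ≤ 7
branching-≤7 (finished _) = z≤n
branching-≤7 (split _)    = ≤-refl

------------------------------------------------------------------------
-- The algorithm

open SearchProgram rootₜ branchₜ using (program; runs)

-- The answer of the program on G and k.
decideSolution : ∀ {n} → Graph n → ℕ → Bool
decideSolution G k = search (λ U → ⟦ branchₜ ⟧ (matrix G ∷ U ∷ [])) k (⟦ rootₜ ⟧ (matrix G ∷ []))

theorem7 : ∃[ P ] ∃[ c ]
    ((n : ℕ) (G : Graph n) (k : ℕ) →
    ∃[ answer ] ∃[ t ]
    Runs {2} P (encodeGraph G ∷ encodeℕ k ∷ []) (encodeBool answer) t
    × t ≤ 7 ^ k * (c * suc n ^ c)
    × Reflects (HasSolutionOfSize≤ G k) answer)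
theorem7 = program , proj₁ bounded , λ n G k →
  let open GraphTheory G
      t , run , t≤ = proj₂ bounded {n} (matrix G) (λ U → branching-≤7 (Correctness.branching G U)) k
  in  decideSolution G k , t
      , subst (λ g → Runs program (g ∷ encodeℕ k ∷ []) (encodeBool (decideSolution G k)) t) (enc-matrix G) run
      , t≤
      , map-reflects (solvable⇒hasSolution everything) hasSolution⇒solvable
          (search-reflects G (Correctness.branching G) k (tabulate λ _ → true))
  where
  bounded = runs {7} (s≤s (s≤s z≤n))
  everything : ∀ {n} (v : Fin n) → v ∈ tabulate λ _ → true
  everything v = lookup⇒[]= v _ (lookup∘tabulate (λ _ → true) v)
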